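{- Let $N$ be a conflict-free structural conflict net. Then $N$ has a $\sqsubseteq_1^\infty$-largest BD-process; that is, there is a GR-process $P$ of $N$ such that $Q\sqsubseteq_1^\infty P$ for every GR-process $Q$ of $N$.
   Context: **Multisets.** A multiset over a set $X$ is a function $A:X\to\mathbb{N}$ (with $0\in\mathbb{N}$); $x\in A$ iff $A(x)>0$; $A\subseteq B$ iff $A(x)\le B(x)$ for all $x$; $(A+B)(x)=A(x)+B(x)$; $(A-B)(x)=\max(A(x)-B(x),0)$; $|A|=\sum_x A(x)$; $A$ is finite iff $|A|<\infty$. $\{t,u\}$ denotes a multiset (so $\{t,t\}$ contains $t$ twice). $G\upharpoonright\{t\}$ is the restriction of $G$ to $\{t\}$, i.e. the multiset consisting of $G(t)$ copies of $t$. A multiset with all values $\le 1$ is identified with a set, and multisets that differ only in their underlying domain (by elements of multiplicity 0) are identified. **Nets.** A net is a tuple $N=(S,T,F,M_0)$ with $S,T$ disjoint sets (places, transitions), $F:(S\times T)\cup(T\times S)\to\mathbb{N}$, and $M_0:S\to\mathbb{N}$ (initial marking), such that for all $t\in T$ the set $\{s\mid F(s,t)>0\}$ is finite and non-empty and $\{s\mid F(t,s)>0\}$ is finite. For $x\in S\cup T$ the multisets ${}^\bullet x$ and $x^\bullet$ are given by ${}^\bullet x(y)=F(y,x)$ and $x^\bullet(y)=F(x,y)$ (with $F$ taken to be $0$ where undefined), extended linearly to multisets $X$ by ${}^\bullet X=\sum_x X(x)\cdot{}^\bullet x$, $X^\bullet=\sum_x X(x)\cdot x^\bullet$. A marking is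 a multiset $M\in\mathbb{N}^S$. For a non-empty finite multiset $G\in\mathbb{N}^T$, $M\xrightarrow{G}M'$ iff ${}^\bullet G\subseteq M$ and $M'=(M-{}^\bullet G)+G^\bullet$; write $M\xrightarrow{G}$ if such $M'$ exists. For a word $\sigma=t_1\cdots t_n\in T^*$, $M\xrightarrow{\sigma}M'$ means that firing the single transitions $t_1,\dots,t_n$ in this order leads from $M$ to $M'$ (for the empty word, $M'=M$). $M$ is reachable iff $M_0\xrightarrow{\sigma}M$ for some $\sigma\in T^*$. **Conflict.** A finite non-empty multiset $G\in\mathbb{N}^T$ is in (semantic) conflict in $M$ iff not $M\xrightarrow{G}$, but $M\xrightarrow{G\upharpoonright\{t\}}$ for all $t\in G$. $N$ is (semantically) conflict-free iff no finite non-empty multiset $G\in\mathbb{N}^T$ is in semantic conflict in any reachable marking. $N$ is a structural conflict net iff for all $t,u\in T$ (possibly $t=u$): if $M\xrightarrow{\{t,u\}}$ for some reachable marking $M$, then ${}^\bullet t\cap{}^\bullet u=\emptyset$. **GR-processes.** A (GR-)process of $N=(S,T,F,M_0)$ is a pair $P=(\mathcal{N},\pi)$ where $\mathcal{N}=(\mathcal{S},\mathcal{T},\mathcal{F},\mathcal{M}_0)$ is a net such that: (i) for all $s\in\mathcal{S}$, $|{}^\bullet s|\le 1$, $|s^\bullet|\le 1$, and $\mathcal{M}_0(s)=1$ if ${}^\bullet s=\emptyset$ and $\mathcal{M}_0(s)=0$ otherwise; (ii) $\mathcal{F}$ is acyclic, i.e. $(x,x)\notin\mathcal{F}^+$ for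 all $x\in\mathcal S\cup\mathcal T$, where $\mathcal{F}^+$ is the transitive closure of $\{(x,y)\mid\mathcal{F}(x,y)>0\}$; (iii) $\{t\in\mathcal{T}\mid(t,u)\in\mathcal{F}^+\}$ is finite for all $u\in\mathcal{T}$; and $\pi:\mathcal{S}\cup\mathcal{T}\to S\cup T$ is a function with $\pi(\mathcal{S})\subseteq S$, $\pi(\mathcal{T})\subseteq T$, $M_0(s)=|\pi^{ -1}(s)\cap\mathcal{M}_0|$ for all $s\in S$, and $F(s,\pi(t))=|\pi^{ -1}(s)\cap{}^\bullet t|$, $F(\pi(t),s)=|\pi^{ -1}(s)\cap t^\bullet|$ for all $t\in\mathcal{T}$, $s\in S$. $P$ is finite iff $\mathcal{T}$ is finite. ${\rm GR}(N)$ (resp. ${\rm GR}_{fin}(N)$) is the collection of all (finite) GR-processes of $N$. For processes $P=((\mathcal{S},\mathcal{T},\mathcal{F},\mathcal{M}_0),\pi)$ and $P'=((\mathcal{S}',\mathcal{T}',\mathcal{F}',\mathcal{M}_0'),\pi')$ of the same net, $P'$ is a prefix of $P$ (and $P$ an extension of $P'$), $P'\le P$, iff $\mathcal{S}'\subseteq\mathcal{S}$, $\mathcal{T}'\subseteq\mathcal{T}$, $\mathcal{M}'_0=\mathcal{M}_0$, $\mathcal{F}'=\mathcal{F}\upharpoonright(\mathcal{S}'\times\mathcal{T}'\cup\mathcal{T}'\times\mathcal{S}')$ and $\pi'=\pi\upharpoonright(\mathcal{S}'\cup\mathcal{T}')$. $P\cong P'$ (isomorphic) iff there is a bijection $\phi$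 mapping places to places and transitions to transitions, with $\mathcal{M}'_0(\phi(s))=\mathcal{M}_0(s)$, $\mathcal{F}'(\phi(x),\phi(y))=\mathcal{F}(x,y)$ and $\pi=\pi'\circ\phi$. **Swapping.** For a process $P=((\mathcal{S},\mathcal{T},\mathcal{F},\mathcal{M}_0),\pi)$ and $p,q\in\mathcal{S}$ with $(p,q)\notin\mathcal{F}^+\cup(\mathcal{F}^+)^{ -1}$ and $\pi(p)=\pi(q)$, $\mathrm{swap}(P,p,q)=((\mathcal{S},\mathcal{T},\mathcal{F}',\mathcal{M}_0),\pi)$, where $\mathcal{F}'(p,y)=\mathcal{F}(q,y)$ and $\mathcal{F}'(q,y)=\mathcal{F}(p,y)$ for $y\in\mathcal{T}$, and $\mathcal{F}'(x,y)=\mathcal{F}(x,y)$ otherwise. $P\equiv_1 Q$ iff $\mathrm{swap}(P,p,q)\cong Q$ for some such places $p,q$ of $P$; $\equiv_1^*$ is the reflexive and transitive closure of $\equiv_1$. **BD-processes and their order.** For $P,Q\in{\rm GR}(N)$, $P\equiv_1^\infty Q$ iff for every finite $P''\le P$ there are $Q'\equiv_1^* Q$ and $Q''\le Q'$ with $P''\cong Q''$, and vice versa, for every finite $Q''\le Q$ there are $P'\equiv_1^*P$ and $P''\le P'$ with $P''\cong Q''$. A BD-process is a $\equiv_1^\infty$-equivalence class of GR-processes. $P\sqsubseteq_1^\infty Q$ iff for every finite $P''\le P$ there are $P',Q'\in{\rm GR}_{fin}(N)$ with $P''\le P'\equiv_1^*Q'\le Q$. The relation $\sqsubseteq_1^\infty$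 is a preorder with kernel $\equiv_1^\infty$, hence induces a partial order on BD-processes; "$\sqsubseteq_1^\infty$-largest" refers to this order. -}

module Defs where

open import Axiom.ExcludedMiddle using (ExcludedMiddle)
open import Data.Bool.Base using (if_then_else_)
open import Data.Fin.Base using (Fin)
open import Data.List.Base using (List; []; _∷_)
open import Data.List.Membership.Propositional using (_∈_)
open import Data.Nat.Base using (ℕ; _+_; _*_; _∸_; _⊓_; _≤_; _<_)
open import Data.Product.Base using (Σ; Σ-syntax; ∃; ∃-syntax; _×_)
open import Data.Sum.Base using (_⊎_; inj₁; inj₂)
open import Function.Base using (_∘_)
open import Function.Bundles using (_↔_; Inverse)
open import Function.Definitions using (Injective)
open import Level using (Level; suc; Lift; lift; lower)
open import Relation.Binary.Construct.Closure.ReflexiveTransitive using (Star)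
open import Relation.Binary.Construct.Closure.Transitive using (TransClosure)
open import Relation.Binary.Definitions using (DecidableEquality)
open import Relation.Binary.PropositionalEquality using (_≡_; _≗_)
open import Relation.Nullary.Decidable using (map′; does)
open import Relation.Nullary.Negation using (¬_)
open import Relation.Unary using (Pred; U)

private
  variable
    a : Level
    X : Set a

-- P may be proof-relevant, so finiteness of the set of its elements is
-- expressed by a covering list rather than by counting Σ X P.
Finite : ∀ {p} → Pred X p → Set _
Finite {X = X} P = Σ[ xs ∈ List X ] (∀ {x} → P x → x ∈ xs)

------------------------------------------------------------------------
-- Multisets

Multiset : Set a → Set a
Multiset X = X → ℕ

infix 4 _∈ₘ_ _⊆ₘ_
infixl 6 _+ₘ_ _-ₘ_
infixr 7 _∩ₘ_

_∈ₘ_ : X → Multiset X → Set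
x ∈ₘ A = 0 < A x

_⊆ₘ_ : Multiset X → Multiset X → Set _
A ⊆ₘ B = ∀ x → A x ≤ B x

_+ₘ_ _-ₘ_ _∩ₘ_ : Multiset X → Multiset X → Multiset X
(A +ₘ B) x = A x + B x
(A -ₘ B) x = A x ∸ B x
(A ∩ₘ B) x = A x ⊓ B x

Empty : Multiset X → Set _
Empty A = ∀ x → A x ≡ 0

-- |A| = Σₓ A(x) may be infinite and is therefore a relation. The type
-- Σ X (Fin ∘ A) has A x elements over each x.
∣_∣≐_ : Multiset X → ℕ → Set _
∣_∣≐_ {X = X} A n = Fin n ↔ Σ X (Fin ∘ A)

∣_∣≤1 : Multiset X → Set _
∣ A ∣≤1 = ∃[ n ] ∣ A ∣≐ n × n ≤ 1

FiniteMultiset : Multiset X → Set _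
FiniteMultiset A = ∃[ n ] ∣ A ∣≐ n

------------------------------------------------------------------------
-- Nets

-- Places and transitions are separate types, hence disjoint; the flow
-- function F is given by its two components.
record RawNet ℓ : Set (suc ℓ) where
  field
    S   : Set ℓ
    T   : Set ℓ
    Fˢᵗ : S → T → ℕ
    Fᵗˢ : T → S → ℕ
    M₀  : Multiset S

  F : S ⊎ T → S ⊎ T → ℕ
  F (inj₁ s) (inj₂ t) = Fˢᵗ s t
  F (inj₂ t) (inj₁ s) = Fᵗˢ t s
  F (inj₁ _) (inj₁ _) = 0
  F (inj₂ _) (inj₂ _) = 0

  infix 4 _F⁺_
  _F⁺_ : S ⊎ T → S ⊎ T → Set ℓ
  _F⁺_ = TransClosure (λ x y → 0 < F x y)

  infix 8 •ᵗ_ _ᵗ• •ˢ_ _ˢ•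

  •ᵗ_ _ᵗ• : T → Multiset S
  (•ᵗ t) s = Fˢᵗ s t
  (t ᵗ•) s = Fᵗˢ t s

  •ˢ_ _ˢ• : S → Multiset T
  (•ˢ s) t = Fᵗˢ t s
  (s ˢ•) t = Fˢᵗ s t

  -- A = •G and A = G•, that is, A(s) = Σₜ G(t)·F(s,t) for all s, and
  -- dually. For finite G such an A exists.
  IsPreset IsPostset : Multiset T → Multiset S → Set ℓ
  IsPreset  G A = ∀ s → ∣ (λ t → G t * (•ᵗ t) s) ∣≐ A s
  IsPostset G A = ∀ s → ∣ (λ t → G t * (t ᵗ•) s) ∣≐ A s

  infix 4 _[_⟩_ _[_⟩

  _[_⟩_ : Multiset S → Multiset T → Multiset S → Set ℓ
  M [ G ⟩ M′ = ∃[ •G ] ∃[ G• ] IsPreset G •G × IsPostset G G•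
             × •G ⊆ₘ M × M′ ≗ (M -ₘ •G) +ₘ G•

  _[_⟩ : Multiset S → Multiset T → Set ℓ
  M [ G ⟩ = ∃[ M′ ] M [ G ⟩ M′

record IsNet {ℓ} (N : RawNet ℓ) : Set ℓ where
  open RawNet N
  field
    preset-finite   : ∀ t → Finite (λ s → 0 < (•ᵗ t) s)
    preset-nonempty : ∀ t → ∃[ s ] 0 < (•ᵗ t) s
    postset-finite  : ∀ t → Finite (λ s → 0 < (t ᵗ•) s)

record Net ℓ : Set (suc ℓ) where
  field
    rawNet : RawNet ℓ
    isNet  : IsNet rawNet
  open RawNet rawNet public
  open IsNet isNet public

-- A raw process need not satisfy the axioms of a process.
record RawProcess {ℓ} (N : Net ℓ) : Set (suc ℓ) where
  private module N = Net N
  field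
    rawNet : RawNet ℓ
  open RawNet rawNet public
  field
    πˢ : S → N.S
    πᵗ : T → N.T

infix 4 _≅_
record _≅_ {ℓ} {N : Net ℓ} (P P′ : RawProcess N) : Set ℓ where
  private
    module P  = RawProcess P
    module P′ = RawProcess P′
  field
    places      : P.S ↔ P′.S
    transitions : P.T ↔ P′.T
  φˢ : P.S → P′.S
  φˢ = Inverse.to places
  φᵗ : P.T → P′.T
  φᵗ = Inverse.to transitions
  field
    M₀-pres  : ∀ s → P′.M₀ (φˢ s) ≡ P.M₀ s
    Fˢᵗ-pres : ∀ s t → P′.Fˢᵗ (φˢ s) (φᵗ t) ≡ P.Fˢᵗ s t
    Fᵗˢ-pres : ∀ t s → P′.Fᵗˢ (φᵗ t) (φˢ s) ≡ P.Fᵗˢ t s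
    πˢ-pres  : ∀ s → P.πˢ s ≡ P′.πˢ (φˢ s)
    πᵗ-pres  : ∀ t → P.πᵗ t ≡ P′.πᵗ (φᵗ t)

-- P′ is a prefix of P. Carriers being types, the inclusions of places
-- and transitions are injections, so this is the prefix relation up to
-- isomorphism of P′. By M₀-covered, M₀ of P vanishes outside P′.
record RawPrefix {ℓ} {N : Net ℓ} (P′ P : RawProcess N) : Set ℓ where
  private
    module P  = RawProcess P
    module P′ = RawProcess P′
  field
    ιˢ : P′.S → P.S
    ιᵗ : P′.T → P.T
    ιˢ-injective : Injective _≡_ _≡_ ιˢ
    ιᵗ-injective : Injective _≡_ _≡_ ιᵗ
    M₀-pres    : ∀ s → P′.M₀ s ≡ P.M₀ (ιˢ s)
    M₀-covered : ∀ s → s ∈ₘ P.M₀ → ∃[ s′ ] ιˢ s′ ≡ s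
    Fˢᵗ-pres   : ∀ s t → P′.Fˢᵗ s t ≡ P.Fˢᵗ (ιˢ s) (ιᵗ t)
    Fᵗˢ-pres   : ∀ t s → P′.Fᵗˢ t s ≡ P.Fᵗˢ (ιᵗ t) (ιˢ s)
    πˢ-pres    : ∀ s → P′.πˢ s ≡ P.πˢ (ιˢ s)
    πᵗ-pres    : ∀ t → P′.πᵗ t ≡ P.πᵗ (ιᵗ t)

------------------------------------------------------------------------
-- Notions that need equality on arbitrary sets to be decidable, as it is
-- classically. Excluded middle is assumed at level suc ℓ, where
-- statements quantifying over processes live.

module PetriNets {ℓ} (em : ExcludedMiddle (suc ℓ)) where

  infix 4 _≟_
  _≟_ : {X : Set ℓ} → DecidableEquality X
  x ≟ y = map′ lower lift (em {Lift (suc ℓ) (x ≡ y)})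

  ⟅_⟆ : {X : Set ℓ} → X → Multiset X
  ⟅ x ⟆ y = if does (x ≟ y) then 1 else 0

  infixl 8 _↾_
  _↾_ : {X : Set ℓ} → Multiset X → X → Multiset X
  (A ↾ x) y = if does (x ≟ y) then A y else 0

  infix 9 _⁻¹⟨_⟩
  _⁻¹⟨_⟩ : {X Y : Set ℓ} → (X → Y) → Y → Multiset X
  (f ⁻¹⟨ y ⟩) x = ⟅ y ⟆ (f x)

  module _ (N : Net ℓ) where
    open Net N

    infix 4 _⟦_⟩_
    _⟦_⟩_ : Multiset S → List T → Multiset S → Set ℓ
    M ⟦ []    ⟩ M′ = M′ ≗ M
    M ⟦ t ∷ σ ⟩ M′ = ∃[ M″ ] M [ ⟅ t ⟆ ⟩ M″ × M″ ⟦ σ ⟩ M′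

    Reachable : Multiset S → Set ℓ
    Reachable M = ∃[ σ ] M₀ ⟦ σ ⟩ M

    InConflict : Multiset T → Multiset S → Set ℓ
    InConflict G M = ¬ (M [ G ⟩) × (∀ t → t ∈ₘ G → M [ G ↾ t ⟩)

    ConflictFree : Set ℓ
    ConflictFree = ∀ G → FiniteMultiset G → (∃[ t ] t ∈ₘ G) →
                   ∀ M → Reachable M → ¬ InConflict G M

    IsStructuralConflictNet : Set ℓ
    IsStructuralConflictNet = ∀ t u M → Reachable M →
                              M [ ⟅ t ⟆ +ₘ ⟅ u ⟆ ⟩ → Empty (•ᵗ t ∩ₘ •ᵗ u)

  record IsGRProcess {N : Net ℓ} (P : RawProcess N) : Set ℓ where
    private module N = Net N
    open RawProcess P
    field
      isNet : IsNet rawNet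

      preset-≤1      : ∀ s → ∣ •ˢ s ∣≤1
      postset-≤1     : ∀ s → ∣ s ˢ• ∣≤1
      M₀-initial     : ∀ s → Empty (•ˢ s) → M₀ s ≡ 1
      M₀-non-initial : ∀ s → ¬ Empty (•ˢ s) → M₀ s ≡ 0

      acyclic      : ∀ x → ¬ (x F⁺ x)
      finite-past  : ∀ u → Finite (λ t → inj₂ t F⁺ inj₂ u)

      π-M₀      : ∀ s → ∣ πˢ ⁻¹⟨ s ⟩ ∩ₘ M₀ ∣≐ N.M₀ s
      π-preset  : ∀ t s → ∣ πˢ ⁻¹⟨ s ⟩ ∩ₘ •ᵗ t ∣≐ N.Fˢᵗ s (πᵗ t)
      π-postset : ∀ t s → ∣ πˢ ⁻¹⟨ s ⟩ ∩ₘ t ᵗ• ∣≐ N.Fᵗˢ (πᵗ t) s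

  record GRProcess (N : Net ℓ) : Set (suc ℓ) where
    field
      rawProcess  : RawProcess N
      isGRProcess : IsGRProcess rawProcess
    open RawProcess rawProcess public
    open IsGRProcess isGRProcess public

  open GRProcess using (rawProcess)

  swap : {N : Net ℓ} (P : RawProcess N) (p q : RawProcess.S P) → RawProcess N
  swap P p q = record
    { rawNet = record
      { S   = S
      ; T   = T
      ; Fˢᵗ = λ x y → if does (x ≟ p) then Fˢᵗ q y else
                      if does (x ≟ q) then Fˢᵗ p y else Fˢᵗ x y
      ; Fᵗˢ = Fᵗˢ
      ; M₀  = M₀
      }
    ; πˢ = πˢ
    ; πᵗ = πᵗ
    }
    where open RawProcess P

  module _ {N : Net ℓ} where

    infix 4 _≼_ _≡₁_ _≡₁*_ _⊑₁^∞_

    FiniteProcess : GRProcess N → Set ℓ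
    FiniteProcess P = Finite {X = GRProcess.T P} U

    _≼_ : GRProcess N → GRProcess N → Set ℓ
    P′ ≼ P = RawPrefix (rawProcess P′) (rawProcess P)

    _≡₁_ : GRProcess N → GRProcess N → Set ℓ
    P ≡₁ Q = ∃[ p ] ∃[ q ] ¬ (inj₁ p F⁺ inj₁ q) × ¬ (inj₁ q F⁺ inj₁ p)
           × πˢ p ≡ πˢ q × swap (rawProcess P) p q ≅ rawProcess Q
      where open RawProcess (rawProcess P)

    _≡₁*_ : GRProcess N → GRProcess N → Set (suc ℓ)
    _≡₁*_ = Star _≡₁_

    -- The BD-processes of N are the classes of the kernel of this
    -- preorder, ordered by comparing representatives.
    _⊑₁^∞_ : GRProcess N → GRProcess N → Set (suc ℓ)
    P ⊑₁^∞ Q = ∀ P″ → FiniteProcess P″ → P″ ≼ P →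
               ∃[ P′ ] ∃[ Q′ ] FiniteProcess P′ × FiniteProcess Q′
               × P″ ≼ P′ × P′ ≡₁* Q′ × Q′ ≼ Q

{-# OPTIONS --safe #-}

-- Conflict-freeness and the structural condition make N persistent:
-- distinct transitions enabled together have disjoint presets. Hence a
-- firing sequence σ whose occurrences are among those of τ can be
-- continued to a sequence that is obtained from τ by exchanging adjacent
-- concurrent transitions.
--
-- The largest process arises from M₀ by firing, at every stage, all
-- enabled transitions at once. By persistence, the occurrences of any
-- firing sequence are among those of a finite prefix of it. So a finite
-- process can be linearised and continued until it has the same
-- occurrences as such a prefix.
--
-- Processes with the same linearisation are related by swaps: go through
-- the inputs in firing order and exchange the two tokens wherever the
-- processes differ. Passing to a linearisation with two adjacent
-- concurrent transitions exchanged is possible since some process admits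
-- both linearisations.

module Submission where

open import Axiom.ExcludedMiddle using (ExcludedMiddle)
open import Data.Bool.Base using (if_then_else_)
open import Data.Bool.Properties using (T-irrelevant)
open import Data.Empty using (⊥; ⊥-elim)
open import Data.Fin.Base using (Fin; zero; suc; toℕ; fromℕ<)
open import Data.Fin.Properties using (toℕ<n; toℕ-fromℕ<; toℕ-injective)
open import Data.List.Base
  using (List; []; _∷_; _++_; _ʳ++_; length; map; filter; concatMap; allFin; upTo; reverse)
import Data.List.Membership.DecPropositional as DecMembership
open import Data.List.Membership.Propositional using (_∈_; _∉_; lose)
open import Data.List.Membership.Propositional.Properties
  using ( ∈-∃++; ∈-++⁺ˡ; ∈-++⁺ʳ; ∈-++⁻; ∈-filter⁺; ∈-filter⁻; ∈-concatMap⁺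
        ; ∈-map⁺; ∈-map⁻; ∈-allFin; ∈-upTo⁺; ∈-upTo⁻)
open import Data.List.Membership.Propositional.Properties.WithK using (unique⇒irrelevant)
open import Data.List.Properties
  using (length-++; length-map; length-upTo; ++-assoc; ++-identityʳ; reverse-involutive)
open import Data.List.Relation.Unary.All as All using (All)
open import Data.List.Relation.Unary.AllPairs using ([]; _∷_)
open import Data.List.Relation.Unary.Any using (here; there)
open import Data.List.Relation.Unary.Unique.Propositional using (Unique)
open import Data.List.Relation.Unary.Unique.Propositional.Properties
  using (filter⁺; map⁺; ++⁺; upTo⁺)
open import Data.Nat.Base
  using ( ℕ; zero; suc; _+_; _∸_; _*_; _⊓_; _⊔_; _≤_; _<_; z≤n; s≤s
        ; _≤′_; ≤′-refl; ≤′-step)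
open import Data.Nat.Properties as ℕ hiding (_≟_)
open import Data.Product.Base using (Σ; Σ-syntax; ∃-syntax; _×_; _,_; proj₁; proj₂)
open import Data.Sum.Base using (_⊎_; inj₁; inj₂; [_,_]′)
open import Data.Sum.Properties using (inj₁-injective; inj₂-injective)
open import Function.Base using (_∘_; id)
open import Function.Bundles using (mk↔ₛ′; Inverse)
open import Function.Construct.Identity using (↔-id)
open import Function.Definitions using (Injective)
open import Level as Level using (Level; Lift; lift; lower)
open import Relation.Binary.Construct.Closure.ReflexiveTransitive as Star
  using (Star; ε; _◅_; _◅◅_; gmap)
open import Relation.Binary.Construct.Closure.Transitive as Plus using ([_]; _∷_; _∷ʳ_)
open import Relation.Binary.Definitions using (DecidableEquality)
open import Relation.Binary.PropositionalEquality
open import Relation.Nullary using (¬_; ¬?; yes; no; Dec; does)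
open import Relation.Nullary.Decidable
  using (True; toWitness; fromWitness; map′; dec-true; dec-false)

open import Defs

-- Carriers of processes are arbitrary types, so comparing processes directly would mean carrying
-- isomorphisms through every step. Instead each process is put in a normal form in which events are
-- numbered firings `(t , k)` and tokens are named by their origin. All that remains free is an
-- assignment of tokens to inputs. Over a fixed set of events all such processes share their
-- carriers; a prefix is an inclusion of events on which assignments agree, and a swap transposes
-- two values. Numbering also turns inclusion between sets of occurrences into an inequality between
-- counts.
--
-- Firing sequences and assignments are linked by counting: an assignment can be extended as soon as
-- there are enough tokens, and an injective assignment that respects the firing order shows that
-- there are enough.
--
-- A stage of the largest process may be infinite, since infinitely many transitions can be ready at
-- once, while persistence speaks of finite sequences. Finite sets of events closed under inputs
-- mediate: any finitely many tokens exist after one of them, as they have unions within one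
-- process.

private
  variable
    a b : Level
    A : Set a
    B : Set b

-- Lists, injections and cardinalities

length-++-∷ : ∀ (xs : List A) {y ys} → length (xs ++ y ∷ ys) ≡ suc (length (xs ++ ys))
length-++-∷ []       = refl
length-++-∷ (x ∷ xs) = cong suc (length-++-∷ xs)

injection-length : ∀ {xs : List A} {ys : List B} (g : A → B) → Unique xs →
  (∀ {x} → x ∈ xs → g x ∈ ys) →
  (∀ {x y} → x ∈ xs → y ∈ xs → g x ≡ g y → x ≡ y) → length xs ≤ length ys
injection-length {xs = []}     g _            _   _   = z≤n
injection-length {xs = x ∷ xs} {ys} g (x∉xs ∷ xs!) sub inj
  with as , bs , refl ← ∈-∃++ (sub (here refl)) =
  subst (suc (length xs) ≤_) (sym (length-++-∷ as)) (s≤s (injection-length g xs! sub′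
    (λ x∈ y∈ → inj (there x∈) (there y∈))))
  where
  sub′ : ∀ {y} → y ∈ xs → g y ∈ as ++ bs
  sub′ {y} y∈xs with ∈-++⁻ as (sub (there y∈xs))
  ... | inj₁ ∈as         = ∈-++⁺ˡ ∈as
  ... | inj₂ (there ∈bs) = ∈-++⁺ʳ as ∈bs
  ... | inj₂ (here eq)   =
    ⊥-elim (All.lookup x∉xs y∈xs (sym (inj (there y∈xs) (here refl) eq)))

nth : A → List A → ℕ → A
nth d []       _       = d
nth d (x ∷ xs) zero    = x
nth d (x ∷ xs) (suc j) = nth d xs j

nth-∈ : ∀ {d : A} xs {j} → j < length xs → nth d xs j ∈ xs
nth-∈ (x ∷ xs) {zero}  _       = here refl
nth-∈ (x ∷ xs) {suc j} (s≤s p) = there (nth-∈ xs p)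

nth-injective : ∀ {d : A} {xs i j} → Unique xs → i < length xs → j < length xs →
  nth d xs i ≡ nth d xs j → i ≡ j
nth-injective {xs = x ∷ xs} {zero}  {zero}  _ _ _ _ = refl
nth-injective {xs = x ∷ xs} {zero}  {suc j} (x∉ ∷ _) _ (s≤s q) eq =
  ⊥-elim (All.lookup x∉ (nth-∈ xs q) eq)
nth-injective {xs = x ∷ xs} {suc i} {zero}  (x∉ ∷ _) (s≤s p) _ eq =
  ⊥-elim (All.lookup x∉ (nth-∈ xs p) (sym eq))
nth-injective {xs = x ∷ xs} {suc i} {suc j} (_ ∷ u) (s≤s p) (s≤s q) eq =
  cong suc (nth-injective u p q eq)

-- Pigeonhole: every element of `xs` lies in `free` or in `ys`, so `free` has at least `n` entries.
-- Repetitions in `ys` and entries outside `xs` do no harm. Values from `n` on carry no meaning.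
choose-outside : DecidableEquality A → A → ∀ {xs} (ys : List A) n → Unique xs →
  n + length ys ≤ length xs →
  Σ[ d ∈ (ℕ → A) ] (∀ {j} → j < n → d j ∈ xs × d j ∉ ys) ×
                   (∀ {i j} → i < n → j < n → d i ≡ d j → i ≡ j)
choose-outside {A = A} _≟_ a {xs} ys n xs! n+∣ys∣≤∣xs∣ =
  nth a free ,
  (λ j<n → ∈-filter⁻ outside? {xs = xs} (nth-∈ free (<-≤-trans j<n n≤∣free∣))) ,
  (λ i<n j<n → nth-injective (filter⁺ outside? xs!)
                 (<-≤-trans i<n n≤∣free∣) (<-≤-trans j<n n≤∣free∣))
  where
  open DecMembership _≟_ using (_∈?_)
  outside? = λ x → ¬? (x ∈? ys)
  free = filter outside? xs

  xs⊆free++ys : ∀ {x} → x ∈ xs → x ∈ free ++ ys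
  xs⊆free++ys {x} x∈xs with x ∈? ys
  ... | yes x∈ys = ∈-++⁺ʳ free x∈ys
  ... | no  x∉ys = ∈-++⁺ˡ (∈-filter⁺ outside? x∈xs x∉ys)

  n≤∣free∣ : n ≤ length free
  n≤∣free∣ = +-cancelʳ-≤ (length ys) n (length free)
    (≤-trans n+∣ys∣≤∣xs∣ (subst (length xs ≤_) (length-++ free)
      (injection-length id xs! xs⊆free++ys (λ _ _ eq → eq))))

Fin-≤1-irrelevant : ∀ {n} → n ≤ 1 → (i j : Fin n) → i ≡ j
Fin-≤1-irrelevant (s≤s z≤n) zero zero = refl

⊓-pos⁺ : ∀ {m n} → 0 < m → 0 < n → 0 < m ⊓ n
⊓-pos⁺ (s≤s _) (s≤s _) = s≤s z≤n

⊓-pos⁻ : ∀ {m n} → 0 < m ⊓ n → 0 < m × 0 < n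
⊓-pos⁻ {suc m} {suc n} _ = s≤s z≤n , s≤s z≤n

fiber-≡ : ∀ {A : Multiset B} → (∀ x → A x ≤ 1) → {x y : Σ B (Fin ∘ A)} → proj₁ x ≡ proj₁ y → x ≡ y
fiber-≡ A≤1 {x , i} {.x , j} refl = cong (x ,_) (Fin-≤1-irrelevant (A≤1 x) i j)

-- With multiplicities at most one, the component in `Fin (A x)` carries no information, so the
-- bijection amounts to listing the elements without repetition.
enumerate⇒∣∣≐ : ∀ {A : Multiset B} {n} → (∀ x → A x ≤ 1) → (g : Fin n → B) → (∀ i → g i ∈ₘ A) →
  Injective _≡_ _≡_ g → (∀ {x} → x ∈ₘ A → ∃[ i ] g i ≡ x) → ∣ A ∣≐ n
enumerate⇒∣∣≐ {A = A} A≤1 g g∈A g-inj g-surj = mk↔ₛ′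
  (λ i → g i , fromℕ< (g∈A i))
  (λ (x , k) → proj₁ (g-surj (pos k)))
  (λ (x , k) → fiber-≡ A≤1 (proj₂ (g-surj (pos k))))
  (λ i → g-inj (proj₂ (g-surj (pos (fromℕ< (g∈A i))))))
  where
  pos : ∀ {n} → Fin n → 0 < n
  pos {suc n} _ = s≤s z≤n

∣∣≐⇒enumerate : ∀ {A : Multiset B} {n} → (∀ x → A x ≤ 1) → ∣ A ∣≐ n →
  Σ[ g ∈ (Fin n → B) ] (∀ i → g i ∈ₘ A) × Injective _≡_ _≡_ g × (∀ {x} → x ∈ₘ A → ∃[ i ] g i ≡ x)
∣∣≐⇒enumerate {A = A} A≤1 F =
  proj₁ ∘ to ,
  (λ i → pos (proj₂ (to i))) ,
  (λ {i} {j} eq → trans (sym (strictlyInverseʳ i))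
                    (trans (cong from (fiber-≡ A≤1 eq)) (strictlyInverseʳ j))) ,
  (λ {x} x∈A → from (x , fromℕ< x∈A) , cong proj₁ (strictlyInverseˡ (x , fromℕ< x∈A)))
  where
  open Inverse F
  pos : ∀ {n} → Fin n → 0 < n
  pos {suc n} _ = s≤s z≤n

irrelevant⇒≤1 : ∀ {n} → ((i j : Fin n) → i ≡ j) → n ≤ 1
irrelevant⇒≤1 {zero}        _   = z≤n
irrelevant⇒≤1 {suc zero}    _   = s≤s z≤n
irrelevant⇒≤1 {suc (suc n)} irr with () ← irr zero (suc zero)

∣∣≤1⇒irrelevant : ∀ {A : Multiset B} → ∣ A ∣≤1 → (x y : Σ B (Fin ∘ A)) → x ≡ y
∣∣≤1⇒irrelevant (n , F , n≤1) x y = trans (sym (strictlyInverseˡ x))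
  (trans (cong to (Fin-≤1-irrelevant n≤1 (from x) (from y))) (strictlyInverseˡ y))
  where open Inverse F

∣∣≤1⇒≤1 : ∀ {A : Multiset B} → ∣ A ∣≤1 → ∀ x → A x ≤ 1
∣∣≤1⇒≤1 {A = A} h x = irrelevant⇒≤1 (λ i j → lemma (∣∣≤1⇒irrelevant h (x , i) (x , j)))
  where
  lemma : ∀ {i j : Fin (A x)} → _≡_ {A = Σ _ (Fin ∘ A)} (x , i) (x , j) → i ≡ j
  lemma refl = refl

∣∣≤1⇒unique : ∀ {A : Multiset B} → ∣ A ∣≤1 → ∀ {x y} → x ∈ₘ A → y ∈ₘ A → x ≡ y
∣∣≤1⇒unique h x∈A y∈A = cong proj₁ (∣∣≤1⇒irrelevant h (_ , fromℕ< x∈A) (_ , fromℕ< y∈A))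

if-yes : ∀ {P : Set b} (P? : Dec P) {x y : A} → P → (if does P? then x else y) ≡ x
if-yes P? p rewrite dec-true P? p = refl

if-no : ∀ {P : Set b} (P? : Dec P) {x y : A} → ¬ P → (if does P? then x else y) ≡ y
if-no P? ¬p rewrite dec-false P? ¬p = refl

module _ {ℓ} (em : ExcludedMiddle (Level.suc ℓ)) (N : Net ℓ) where

  open PetriNets em
  private module N = Net N
  open N using (S; T; Fˢᵗ; Fᵗˢ; M₀; •ᵗ_; _ᵗ•; _[_⟩; _[_⟩_)

  -- Firing sequences and persistence

  decide : (A : Set ℓ) → Dec A
  decide A = map′ lower lift (em {Lift _ A})

  -- By unfolding, `⟅ t ⟆ u` is `χ (t ≡ u)`, so the lemmas below also serve for singletons.
  χ : Set ℓ → ℕ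
  χ A = if does (decide A) then 1 else 0

  χ-yes : ∀ {A} → A → χ A ≡ 1
  χ-yes {A} = if-yes (decide A)

  χ-no : ∀ {A} → ¬ A → χ A ≡ 0
  χ-no {A} = if-no (decide A)

  χ-pos⁺ : ∀ {A} → A → 0 < χ A
  χ-pos⁺ a = subst (0 <_) (sym (χ-yes a)) (s≤s z≤n)

  χ-pos⁻ : ∀ {A} → 0 < χ A → A
  χ-pos⁻ {A} p with em {Lift _ A}
  ... | yes (lift a) = a

  χ≤1 : ∀ A → χ A ≤ 1
  χ≤1 A with em {Lift _ A}
  ... | yes _ = s≤s z≤n
  ... | no  _ = z≤n

  χ-cong : ∀ {A B} → (A → B) → (B → A) → χ A ≡ χ B
  χ-cong {A} {B} f g with em {Lift _ A}
  ... | yes (lift a) = sym (χ-yes (f a))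
  ... | no ¬a = sym (χ-no (¬a ∘ lift ∘ g))

  count : List T → T → ℕ
  count []      t = 0
  count (u ∷ σ) t = ⟅ u ⟆ t + count σ t

  consumed produced : List T → S → ℕ
  consumed []      s = 0
  consumed (t ∷ σ) s = Fˢᵗ s t + consumed σ s
  produced []      s = 0
  produced (t ∷ σ) s = Fᵗˢ t s + produced σ s

  -- Firing sequences are listed with the latest transition first. That t is
  -- enabled after σ is stated with the tokens consumed so far on the left,
  -- which avoids subtraction.
  Enabled : List T → T → Set ℓ
  Enabled σ t = ∀ s → Fˢᵗ s t + consumed σ s ≤ M₀ s + produced σ s

  infixr 5 _∷_
  data Firable : List T → Set ℓ where
    []  : Firable []
    _∷_ : ∀ {t σ} → Enabled σ t → Firable σ → Firable (t ∷ σ)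

  count-here : ∀ t σ → count (t ∷ σ) t ≡ suc (count σ t)
  count-here t σ = cong (_+ count σ t) (χ-yes refl)

  count-there : ∀ {t u} σ → t ≢ u → count (t ∷ σ) u ≡ count σ u
  count-there σ t≢u = cong (_+ count σ _) (χ-no t≢u)

  count-∷-≤ : ∀ t σ u → count σ u ≤ count (t ∷ σ) u
  count-∷-≤ t σ u = m≤n+m _ _

  count-++ : ∀ α σ t → count (α ++ σ) t ≡ count α t + count σ t
  count-++ []      σ t = refl
  count-++ (u ∷ α) σ t = trans (cong (⟅ u ⟆ t +_) (count-++ α σ t)) (sym (+-assoc (⟅ u ⟆ t) _ _))

  firable-++⁻ : ∀ α {σ} → Firable (α ++ σ) → Firable σ
  firable-++⁻ []      σ!       = σ!
  firable-++⁻ (u ∷ α) (_ ∷ σ!) = firable-++⁻ α σ!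

  firable-ʳ++⁻ : ∀ α {σ} → Firable (α ʳ++ σ) → Firable σ
  firable-ʳ++⁻ []      σ! = σ!
  firable-ʳ++⁻ (u ∷ α) σ! with _ ∷ σ!′ ← firable-ʳ++⁻ α σ! = σ!′

  -- As the latest transition comes first, the split is at the earliest firing of `t`. This is the
  -- firing that can be moved back to any point where `t` is enabled.
  count-pos⇒split : ∀ σ {t} → 0 < count σ t →
    ∃[ α ] ∃[ β ] σ ≡ α ++ t ∷ β × count β t ≡ 0
  count-pos⇒split (u ∷ σ) {t} p with count σ t in eq
  ... | suc _ with α , β , refl , β∌t ← count-pos⇒split σ {t} (subst (0 <_) (sym eq) (s≤s z≤n)) =
    u ∷ α , β , refl , β∌t
  count-pos⇒split (u ∷ σ) {t} p | zero with refl ← χ-pos⁻ (subst (0 <_) (+-identityʳ (⟅ u ⟆ t)) p) =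
    [] , σ , refl , eq

  data Swap : List T → List T → Set ℓ where
    here  : ∀ {t u σ} → t ≢ u → Enabled σ t → Enabled σ u → Swap (t ∷ u ∷ σ) (u ∷ t ∷ σ)
    there : ∀ {v σ τ} → Swap σ τ → Swap (v ∷ σ) (v ∷ τ)

  infix 4 _≋_
  _≋_ : List T → List T → Set ℓ
  _≋_ = Star Swap

  ++-cong-≋ : ∀ β {σ τ} → σ ≋ τ → β ++ σ ≋ β ++ τ
  ++-cong-≋ []      p = p
  ++-cong-≋ (v ∷ β) p = gmap (v ∷_) there (++-cong-≋ β p)

  +-exchange : ∀ a b c → a + (b + c) ≡ b + (a + c)
  +-exchange a b c = trans (sym (+-assoc a b c)) (trans (cong (_+ c) (+-comm a b)) (+-assoc b a c))

  swap-count : ∀ {σ τ} → Swap σ τ → ∀ t → count σ t ≡ count τ t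
  swap-count (here {t} {u} _ _ _) v = +-exchange (⟅ t ⟆ v) (⟅ u ⟆ v) _
  swap-count (there {w} p)        v = cong (⟅ w ⟆ v +_) (swap-count p v)

  swap-consumed : ∀ {σ τ} → Swap σ τ → ∀ s → consumed σ s ≡ consumed τ s
  swap-consumed (here {t} {u} _ _ _) s = +-exchange (Fˢᵗ s t) (Fˢᵗ s u) _
  swap-consumed (there {v} p)        s = cong (Fˢᵗ s v +_) (swap-consumed p s)

  swap-produced : ∀ {σ τ} → Swap σ τ → ∀ s → produced σ s ≡ produced τ s
  swap-produced (here {t} {u} _ _ _) s = +-exchange (Fᵗˢ t s) (Fᵗˢ u s) _
  swap-produced (there {v} p)        s = cong (Fᵗˢ v s +_) (swap-produced p s)

  swap-enabled : ∀ {σ τ} → Swap σ τ → ∀ {t} → Enabled σ t → Enabled τ t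
  swap-enabled p {t} t! s =
    subst₂ (λ c d → Fˢᵗ s t + c ≤ M₀ s + d) (swap-consumed p s) (swap-produced p s) (t! s)

  swap-sym : ∀ {σ τ} → Swap σ τ → Swap τ σ
  swap-sym (here t≢u t! u!) = here (t≢u ∘ sym) u! t!
  swap-sym (there p)        = there (swap-sym p)

  ≋-count : ∀ {σ τ} → σ ≋ τ → ∀ t → count σ t ≡ count τ t
  ≋-count ε        t = refl
  ≋-count (p ◅ ps) t = trans (swap-count p t) (≋-count ps t)

  ≋-enabled : ∀ {σ τ} → σ ≋ τ → ∀ {t} → Enabled τ t → Enabled σ t
  ≋-enabled ε        t! = t!
  ≋-enabled (p ◅ ps) t! = swap-enabled (swap-sym p) (≋-enabled ps t!)

  ConcurrentlyDisjoint : Set ℓ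
  ConcurrentlyDisjoint = ∀ {σ t u} → Firable σ → Enabled σ t → Enabled σ u → t ≢ u →
    ∀ s → Fˢᵗ s t ≡ 0 ⊎ Fˢᵗ s u ≡ 0

  module Persistence (disjoint : ConcurrentlyDisjoint) where

    -- At each place one of the two transitions takes nothing. The inequality of the other one then
    -- applies there, and the tokens produced by `u` only enlarge its right side.
    persist : ∀ {σ t u} → Firable σ → Enabled σ t → Enabled σ u → t ≢ u → Enabled (u ∷ σ) t
    persist {σ} {t} {u} σ! t! u! t≢u s with disjoint σ! t! u! t≢u s
    ... | inj₁ t0 = begin
      Fˢᵗ s t + (Fˢᵗ s u + consumed σ s)  ≡⟨ cong (_+ (Fˢᵗ s u + consumed σ s)) t0 ⟩
      Fˢᵗ s u + consumed σ s              ≤⟨ u! s ⟩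
      M₀ s + produced σ s                 ≤⟨ +-monoʳ-≤ (M₀ s) (m≤n+m _ (Fᵗˢ u s)) ⟩
      M₀ s + (Fᵗˢ u s + produced σ s)     ∎
      where open ≤-Reasoning
    ... | inj₂ u0 = begin
      Fˢᵗ s t + (Fˢᵗ s u + consumed σ s)  ≡⟨ cong (λ k → Fˢᵗ s t + (k + consumed σ s)) u0 ⟩
      Fˢᵗ s t + consumed σ s              ≤⟨ t! s ⟩
      M₀ s + produced σ s                 ≤⟨ +-monoʳ-≤ (M₀ s) (m≤n+m _ (Fᵗˢ u s)) ⟩
      M₀ s + (Fᵗˢ u s + produced σ s)     ∎
      where open ≤-Reasoning

    count-∷≡0 : ∀ {u t} α → count (u ∷ α) t ≡ 0 → t ≢ u × count α t ≡ 0
    count-∷≡0 {u} {t} α eq =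
      (λ { refl → 1+n≢0 (trans (sym (count-here t α)) eq) }) , m+n≡0⇒n≡0 (⟅ u ⟆ t) eq

    persist* : ∀ α {σ t} → Firable (α ++ σ) → Enabled σ t → count α t ≡ 0 → Enabled (α ++ σ) t
    persist* []      _         t! _  = t!
    persist* (u ∷ α) (u! ∷ σ!) t! eq =
      let t≢u , eq′ = count-∷≡0 α eq in persist σ! (persist* α σ! t! eq′) u! t≢u

    swap-firable : ∀ {σ τ} → Swap σ τ → Firable σ → Firable τ
    swap-firable (here t≢u t! u!) (_ ∷ _ ∷ σ!) = persist σ! u! t! (t≢u ∘ sym) ∷ t! ∷ σ!
    swap-firable (there p)        (v! ∷ σ!)    = swap-enabled p v! ∷ swap-firable p σ!

    ≋-firable : ∀ {σ τ} → σ ≋ τ → Firable σ → Firable τ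
    ≋-firable ε        σ! = σ!
    ≋-firable (p ◅ ps) σ! = ≋-firable ps (swap-firable p σ!)

    -- Being enabled before `α` and not firing in it, `t` stays enabled throughout. It is therefore
    -- concurrent with each transition of `α` in turn and passes them one by one.
    fire-earlier : ∀ α {σ t} → Firable (α ++ σ) → Enabled σ t → count α t ≡ 0 →
                   t ∷ α ++ σ ≋ α ++ t ∷ σ
    fire-earlier []      _         _  _  = ε
    fire-earlier (u ∷ α) (u! ∷ σ!) t! eq =
      let t≢u , eq′ = count-∷≡0 α eq in
      here t≢u (persist* α σ! t! eq′) u! ◅ ++-cong-≋ (u ∷ []) (fire-earlier α σ! t! eq′)

    -- Here σ lists the earliest transition first.
    residual : ∀ σ {b} τ → Firable (σ ʳ++ b) → Firable (τ ++ b) → (∀ t → count σ t ≤ count τ t) →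
               ∃[ α ] τ ++ b ≋ α ++ (σ ʳ++ b)
    residual []      {b} τ _  _  _   = τ , ε
    residual (t ∷ σ) {b} τ σ! τ! σ≤τ
      with α₂ , α₁ , refl , α₁∌t ← count-pos⇒split τ {t}
             (≤-trans (subst (0 <_) (sym (count-here t σ)) (s≤s z≤n)) (σ≤τ t))
      with t! ∷ b! ← firable-ʳ++⁻ σ σ! =
      let α , p = residual σ (α₂ ++ α₁) σ! (≋-firable move τ!) σ≤α₂++α₁ in α , move ◅◅ p
      where
      α₁! : Firable (α₁ ++ b)
      α₁! with _ ∷ h ← firable-++⁻ α₂ (subst Firable (++-assoc α₂ (t ∷ α₁) b) τ!) = h

      -- The next transition of `σ` is enabled after `b`, and `α₁` has no firing of it, so its
      -- earliest firing in `τ` moves to directly after `b`, which then grows by `t`.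
      move : (α₂ ++ t ∷ α₁) ++ b ≋ (α₂ ++ α₁) ++ t ∷ b
      move = subst₂ _≋_ (sym (++-assoc α₂ (t ∷ α₁) b)) (sym (++-assoc α₂ α₁ (t ∷ b)))
               (++-cong-≋ α₂ (fire-earlier α₁ α₁! t! α₁∌t))

      σ≤α₂++α₁ : ∀ u → count σ u ≤ count (α₂ ++ α₁) u
      σ≤α₂++α₁ u = +-cancelˡ-≤ (⟅ t ⟆ u) _ _ (≤-trans (σ≤τ u) (≤-reflexive (begin
        count (α₂ ++ t ∷ α₁) u                  ≡⟨ count-++ α₂ (t ∷ α₁) u ⟩
        count α₂ u + (⟅ t ⟆ u + count α₁ u)     ≡⟨ +-exchange (count α₂ u) (⟅ t ⟆ u) _ ⟩
        ⟅ t ⟆ u + (count α₂ u + count α₁ u)     ≡⟨ cong (⟅ t ⟆ u +_) (sym (count-++ α₂ α₁ u)) ⟩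
        ⟅ t ⟆ u + count (α₂ ++ α₁) u            ∎)))
        where open ≡-Reasoning

    residual-of : ∀ {σ τ} → Firable σ → Firable τ → (∀ t → count σ t ≤ count τ t) → ∃[ α ] τ ≋ α ++ σ
    residual-of {σ} {τ} σ! τ! σ≤τ =
      let α , p = residual (reverse σ) {[]} τ (subst Firable (sym (reverse-involutive σ)) σ!)
                    (subst Firable (sym (++-identityʳ τ)) τ!) reverse-≤
      in α , subst₂ (λ ρ ρ′ → ρ ≋ α ++ ρ′) (++-identityʳ τ) (reverse-involutive σ) p
      where
      count-ʳ++ : ∀ α β t → count (α ʳ++ β) t ≡ count α t + count β t
      count-ʳ++ []      β t = refl
      count-ʳ++ (u ∷ α) β t = trans (count-ʳ++ α (u ∷ β) t)
        (trans (+-exchange (count α t) (⟅ u ⟆ t) _) (sym (+-assoc (⟅ u ⟆ t) _ _)))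
      reverse-≤ : ∀ t → count (reverse σ) t ≤ count τ t
      reverse-≤ t = ≤-trans (≤-reflexive (trans (count-ʳ++ σ [] t) (+-identityʳ _))) (σ≤τ t)

    -- Up to exchanges `τ` is `σ` continued by some `α`. Equal counts mean that `t` does not fire in
    -- `α`, and only its own firing could disable it.
    still-enabled : ∀ {σ τ t} → Firable σ → Firable τ → (∀ u → count σ u ≤ count τ u) →
                    count σ t ≡ count τ t → Enabled σ t → Enabled τ t
    still-enabled {σ} {τ} {t} σ! τ! σ≤τ eq t! with α , p ← residual-of σ! τ! σ≤τ =
      ≋-enabled p (persist* α (≋-firable p τ!) t! (+-cancelʳ-≡ (count σ t) (count α t) 0
        (trans (sym (count-++ α σ t)) (trans (sym (≋-count p t)) (sym eq)))))

  -- Concurrently enabled transitions have disjoint presets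

  supported-at : ∀ {A : Multiset T} {t} → (∀ {u} → t ≢ u → A u ≡ 0) → ∣ A ∣≐ A t
  supported-at {A} {t} off = mk↔ₛ′ (t ,_) from to∘from from∘to
    where
    from : Σ T (Fin ∘ A) → Fin (A t)
    from (u , k) with t ≟ u
    ... | yes refl = k
    ... | no t≢u with () ← subst Fin (off t≢u) k
    to∘from : ∀ x → (t , from x) ≡ x
    to∘from (u , k) with t ≟ u
    ... | yes refl = refl
    ... | no t≢u with () ← subst Fin (off t≢u) k
    from∘to : ∀ k → from (t , k) ≡ k
    from∘to k with t ≟ t
    ... | yes refl = refl
    ... | no t≢t = ⊥-elim (t≢t refl)

  weighted-singleton : ∀ {G : Multiset T} {t} → G t ≡ 1 → (∀ {u} → t ≢ u → G u ≡ 0) → (h : T → ℕ) →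
                       ∣ (λ u → G u * h u) ∣≐ h t
  weighted-singleton {G} {t} Gt off h =
    subst ∣ (λ u → G u * h u) ∣≐_ (trans (cong (_* h t) Gt) (*-identityˡ (h t)))
      (supported-at (λ t≢u → cong (_* h _) (off t≢u)))

  -- Stated for every `G` with the values of a singleton, because the restrictions `G ↾ v` in the
  -- definition of conflict are only pointwise equal to singletons.
  singleton-fires : ∀ {G : Multiset T} {t M} → G t ≡ 1 → (∀ {u} → t ≢ u → G u ≡ 0) → •ᵗ t ⊆ₘ M →
                    M [ G ⟩ ((M -ₘ •ᵗ t) +ₘ t ᵗ•)
  singleton-fires {G} {t} Gt off t! = •ᵗ t , t ᵗ• ,
    (λ s → weighted-singleton Gt off (Fˢᵗ s)) , (λ s → weighted-singleton Gt off (λ u → Fᵗˢ u s)) ,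
    t! , λ _ → refl

  marking : List T → Multiset S
  marking σ s = M₀ s + produced σ s ∸ consumed σ s

  enabled⇒⊆ : ∀ {σ t} → Enabled σ t → •ᵗ t ⊆ₘ marking σ
  enabled⇒⊆ t! s = m+n≤o⇒m≤o∸n _ (t! s)

  marking-∷ : ∀ {σ t} → Enabled σ t → marking (t ∷ σ) ≗ (marking σ -ₘ •ᵗ t) +ₘ t ᵗ•
  marking-∷ {σ} {t} t! s = begin
    m + (p′ + p) ∸ (f + c)    ≡⟨ cong (_∸ (f + c)) (trans (+-exchange m p′ p) (+-comm p′ (m + p))) ⟩
    m + p + p′ ∸ (f + c)      ≡⟨ +-∸-comm p′ (t! s) ⟩
    m + p ∸ (f + c) + p′      ≡⟨ cong (λ k → m + p ∸ k + p′) (+-comm f c) ⟩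
    m + p ∸ (c + f) + p′      ≡⟨ cong (_+ p′) (sym (∸-+-assoc (m + p) c f)) ⟩
    m + p ∸ c ∸ f + p′        ∎
    where
    open ≡-Reasoning
    m = M₀ s
    p = produced σ s
    c = consumed σ s
    f = Fˢᵗ s t
    p′ = Fᵗˢ t s

  ⟦⟧-respˡ : ∀ ρ {M M′ K} → M ≗ M′ → _⟦_⟩_ N M ρ K → _⟦_⟩_ N M′ ρ K
  ⟦⟧-respˡ []      eq K≗M = λ s → trans (K≗M s) (eq s)
  ⟦⟧-respˡ (t ∷ ρ) eq (M″ , (•G , G• , pre , post , ⊆M , M″≗) , rest) =
    M″ , (•G , G• , pre , post , (λ s → subst (•G s ≤_) (eq s) (⊆M s)) ,
      λ s → trans (M″≗ s) (cong (λ k → k ∸ •G s + G• s) (eq s))) , rest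

  -- The two notions list transitions in opposite orders: the latest firing is taken off `σ` and put
  -- in front of the continuation `ρ`.
  firable⇒⟦⟧ : ∀ {σ} → Firable σ → ∀ ρ {K} → _⟦_⟩_ N (marking σ) ρ K → _⟦_⟩_ N M₀ (σ ʳ++ ρ) K
  firable⇒⟦⟧ []                   ρ r = ⟦⟧-respˡ ρ (λ s → +-identityʳ (M₀ s)) r
  firable⇒⟦⟧ (_∷_ {t} {σ} t! σ!) ρ r = firable⇒⟦⟧ σ! (t ∷ ρ) (marking (t ∷ σ) , fires , r)
    where
    fires : marking σ [ ⟅ t ⟆ ⟩ marking (t ∷ σ)
    fires = •ᵗ t , t ᵗ• , (λ s → weighted-singleton (χ-yes refl) χ-no (Fˢᵗ s)) ,
      (λ s → weighted-singleton (χ-yes refl) χ-no (λ u → Fᵗˢ u s)) , enabled⇒⊆ {σ} t! , marking-∷ {σ} t!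

  firable⇒reachable : ∀ {σ} → Firable σ → Reachable N (marking σ)
  firable⇒reachable {σ} σ! = σ ʳ++ [] , firable⇒⟦⟧ σ! [] (λ _ → refl)

  module _ (conflictFree : ConflictFree N) (structural : IsStructuralConflictNet N) where

    -- If the step consisting of `t` and `u` can fire, the structural condition applies to it.
    -- Otherwise it is in conflict: as `t ≢ u`, its restrictions are singletons, and these are
    -- enabled.
    concurrently-disjoint : ConcurrentlyDisjoint
    concurrently-disjoint {σ} {t} {u} σ! t! u! t≢u s with decide (marking σ [ G ⟩)
      where G = ⟅ t ⟆ +ₘ ⟅ u ⟆
    ... | yes G! = ⊓≡0 _ _ (structural t u (marking σ) (firable⇒reachable σ!) G! s)
      where
      ⊓≡0 : ∀ m n → m ⊓ n ≡ 0 → m ≡ 0 ⊎ n ≡ 0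
      ⊓≡0 zero    n       _ = inj₁ refl
      ⊓≡0 (suc m) zero    _ = inj₂ refl
    ... | no ¬G! = ⊥-elim (conflictFree G (2 , enumerate⇒∣∣≐ G≤1 pair pair∈G pair-injective
                     (λ x∈G → pair-surjective (∈G x∈G)))
                     (t , pair∈G zero) (marking σ) (firable⇒reachable σ!) (¬G! , parts!))
      where
      G = ⟅ t ⟆ +ₘ ⟅ u ⟆

      pair : Fin 2 → T
      pair zero       = t
      pair (suc zero) = u

      G-t : G t ≡ 1
      G-t = cong₂ _+_ (χ-yes refl) (χ-no (t≢u ∘ sym))

      G-u : G u ≡ 1
      G-u = cong₂ _+_ (χ-no t≢u) (χ-yes refl)

      pair∈G : ∀ i → pair i ∈ₘ G
      pair∈G zero       = subst (0 <_) (sym G-t) (s≤s z≤n)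
      pair∈G (suc zero) = subst (0 <_) (sym G-u) (s≤s z≤n)

      ∈G : ∀ {v} → v ∈ₘ G → t ≡ v ⊎ u ≡ v
      ∈G {v} v∈G with t ≟ v | u ≟ v
      ... | yes t≡v | _       = inj₁ t≡v
      ... | no _    | yes u≡v = inj₂ u≡v
      ... | no t≢v  | no u≢v with () ← subst (0 <_) (cong₂ _+_ (χ-no t≢v) (χ-no u≢v)) v∈G

      G-∈ : ∀ {v} → t ≡ v ⊎ u ≡ v → G v ≡ 1
      G-∈ (inj₁ refl) = G-t
      G-∈ (inj₂ refl) = G-u

      G≤1 : ∀ v → G v ≤ 1
      G≤1 v with G v in eq
      ... | zero  = z≤n
      ... | suc _ = subst (_≤ 1) eq (≤-reflexive (G-∈ (∈G (subst (0 <_) (sym eq) (s≤s z≤n)))))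

      pair-injective : ∀ {i j} → pair i ≡ pair j → i ≡ j
      pair-injective {zero}     {zero}     _  = refl
      pair-injective {zero}     {suc zero} eq = ⊥-elim (t≢u eq)
      pair-injective {suc zero} {zero}     eq = ⊥-elim (t≢u (sym eq))
      pair-injective {suc zero} {suc zero} _  = refl

      pair-surjective : ∀ {v} → t ≡ v ⊎ u ≡ v → ∃[ i ] pair i ≡ v
      pair-surjective (inj₁ eq) = zero , eq
      pair-surjective (inj₂ eq) = suc zero , eq

      ↾-at : ∀ {v} → (G ↾ v) v ≡ G v
      ↾-at {v} = if-yes (v ≟ v) refl

      ↾-off : ∀ {v w} → v ≢ w → (G ↾ v) w ≡ 0
      ↾-off {v} {w} = if-no (v ≟ w)

      enabled-∈ : ∀ {v} → t ≡ v ⊎ u ≡ v → Enabled σ v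
      enabled-∈ (inj₁ refl) = t!
      enabled-∈ (inj₂ refl) = u!

      parts! : ∀ v → v ∈ₘ G → marking σ [ G ↾ v ⟩
      parts! v v∈G = _ , singleton-fires (trans ↾-at (G-∈ (∈G v∈G))) ↾-off (enabled⇒⊆ {σ} (enabled-∈ (∈G v∈G)))

  -- Processes given by assignments of tokens

  unique⇒∣∣≤1 : ∀ {X : Set ℓ} {A : Multiset X} → (∀ x → A x ≤ 1) →
                (∀ {x y} → x ∈ₘ A → y ∈ₘ A → x ≡ y) → ∣ A ∣≤1
  unique⇒∣∣≤1 {X} {A} A≤1 unique with decide (∃[ x ] x ∈ₘ A)
  ... | yes (x , x∈A) = 1 , enumerate⇒∣∣≐ A≤1 (λ _ → x) (λ _ → x∈A)
                              (λ {i} {j} _ → Fin-≤1-irrelevant (s≤s z≤n) i j)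
                              (λ y∈A → zero , unique x∈A y∈A) , s≤s z≤n
  ... | no ∄ = 0 , enumerate⇒∣∣≐ A≤1 (λ ()) (λ ()) (λ {}) (λ {x} x∈A → ⊥-elim (∄ (x , x∈A))) , z≤n

  Below : (T → ℕ) → T → ℕ → Set
  Below c t k = k < c t

  Occurs : List T → T → ℕ → Set
  Occurs σ = Below (count σ)

  occurs-here : ∀ t σ → Occurs (t ∷ σ) t (count σ t)
  occurs-here t σ = ≤-reflexive (sym (count-here t σ))

  occurs-there : ∀ {t u k} σ → Occurs σ u k → Occurs (t ∷ σ) u k
  occurs-there {t} {u} σ k< = <-≤-trans k< (count-∷-≤ t σ u)

  occurs-∷⁻ : ∀ {t u k} σ → Occurs (t ∷ σ) u k → Occurs σ u k ⊎ (u ≡ t × k ≡ count σ t)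
  occurs-∷⁻ {t} {u} {k} σ k< with t ≟ u
  ... | no t≢u = inj₁ (subst (k <_) (count-there σ t≢u) k<)
  ... | yes refl with m<1+n⇒m<n∨m≡n (subst (k <_) (count-here t σ) k<)
  ...   | inj₁ k<′ = inj₁ k<′
  ...   | inj₂ eq  = inj₂ (refl , eq)

  -- The k-th occurrence of t is the pair (t , k). The tokens on a place s
  -- are named inj₁ i for the i-th initial one and inj₂ (t , k , j) for the
  -- j-th one produced by (t , k). An assignment f names the j-th token
  -- taken from s by (t , k) as f s t k j; its other values are junk.
  Token : Set ℓ
  Token = ℕ ⊎ (T × ℕ × ℕ)

  Assignment : Set ℓ
  Assignment = S → T → ℕ → ℕ → Token

  data IsToken (D : T → ℕ → Set) (s : S) : Token → Set ℓ where
    initial : ∀ {i} → i < M₀ s → IsToken D s (inj₁ i)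
    output  : ∀ {t k j} → D t k → j < Fᵗˢ t s → IsToken D s (inj₂ (t , k , j))

  IsToken-mono : ∀ {D D′ s p} → (∀ {t k} → D t k → D′ t k) → IsToken D s p → IsToken D′ s p
  IsToken-mono D⊆D′ (initial i<)  = initial i<
  IsToken-mono D⊆D′ (output d j<) = output (D⊆D′ d) j<

  InjectiveOn : ∀ {d} → (T → ℕ → Set d) → Assignment → Set (d Level.⊔ ℓ)
  InjectiveOn D f = ∀ {s t k j t′ k′ j′} → D t k → j < Fˢᵗ s t → D t′ k′ → j′ < Fˢᵗ s t′ →
    f s t k j ≡ f s t′ k′ j′ → _≡_ {A = T × ℕ × ℕ} (t , k , j) (t′ , k′ , j′)

  AgreeOn : (T → ℕ → Set) → Assignment → Assignment → Set ℓ
  AgreeOn D f g = ∀ {s t k j} → D t k → j < Fˢᵗ s t → f s t k j ≡ g s t k j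

  -- Only the existence of the tokens at the time of firing is required. That no token is taken
  -- twice is left to `InjectiveOn`, a property of the whole assignment; thus closedness alone has
  -- to be checked when firing orders are merged.
  data Closed (f : Assignment) : List T → Set ℓ where
    []  : Closed f []
    _∷_ : ∀ {t σ} → (∀ {s j} → j < Fˢᵗ s t → IsToken (Occurs σ) s (f s t (count σ t) j)) →
          Closed f σ → Closed f (t ∷ σ)

  closed-token : ∀ {f σ s t k j} → Closed f σ → Occurs σ t k → j < Fˢᵗ s t →
                 IsToken (Occurs σ) s (f s t k j)
  closed-token {σ = u ∷ σ} (u! ∷ σ!) k< j< with occurs-∷⁻ σ k<
  ... | inj₁ k<′           = IsToken-mono (occurs-there σ) (closed-token σ! k<′ j<)
  ... | inj₂ (refl , refl) = IsToken-mono (occurs-there σ) (u! j<)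

  -- `D` may contain infinitely many events. By `support` each of them lies in a finite firing order
  -- closed under inputs, which yields acyclicity and finite pasts at once.
  record Wiring (D : T → ℕ → Set) : Set ℓ where
    field
      irrelevant : ∀ {t k} (d d′ : D t k) → d ≡ d′
      assign     : Assignment
      injective  : InjectiveOn D assign
      support    : ∀ {t k} → D t k →
                   ∃[ σ ] Closed assign σ × Occurs σ t k × (∀ {u i} → Occurs σ u i → D u i)

  Place Event : (T → ℕ → Set) → Set ℓ
  Place D = Σ[ s ∈ S ] Σ[ p ∈ Token ] IsToken D s p
  Event D = Σ[ t ∈ T ] Σ[ k ∈ ℕ ] D t k

  Initial : Token → Set ℓ
  Initial p = ∃[ i ] p ≡ inj₁ i

  Produces : T → ℕ → Token → Set ℓ
  Produces t k p = ∃[ j ] p ≡ inj₂ (t , k , j)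

  Consumes : Assignment → S → T → ℕ → Token → Set ℓ
  Consumes f s t k p = ∃[ j ] j < Fˢᵗ s t × f s t k j ≡ p

  wiredRawProcess : (D : T → ℕ → Set) → Assignment → RawProcess N
  wiredRawProcess D f = record
    { rawNet = record
      { S   = Place D
      ; T   = Event D
      ; Fˢᵗ = λ (s , p , _) (t , k , _) → χ (Consumes f s t k p)
      ; Fᵗˢ = λ (t , k , _) (s , p , _) → χ (Produces t k p)
      ; M₀  = λ (s , p , _) → χ (Initial p)
      }
    ; πˢ = proj₁
    ; πᵗ = proj₁
    }

  eventsOf : ∀ {D} σ → (∀ {t k} → Occurs σ t k → D t k) → List (Event D)
  eventsOf []      sub = []
  eventsOf (t ∷ σ) sub = (t , count σ t , sub (occurs-here t σ)) ∷ eventsOf σ (sub ∘ occurs-there σ)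

  finite-family : ∀ {X : Set ℓ} {p} {P : X → Set p} (ss : List S) (n : S → ℕ) (g : ∀ s → Fin (n s) → X) →
    (∀ {x} → P x → Σ[ s ∈ S ] s ∈ ss × ∃[ i ] g s i ≡ x) → Finite P
  finite-family {P = P} ss n g cover = concatMap items ss , covered
    where
    items : ∀ s → List _
    items s = map (g s) (allFin (n s))
    covered : ∀ {x} → P x → x ∈ concatMap items ss
    covered Px with s , s∈ , i , refl ← cover Px =
      ∈-concatMap⁺ items (lose s∈ (∈-map⁺ (g s) (∈-allFin i)))

  module _ {D : T → ℕ → Set} (W : Wiring D) where
    open Wiring W renaming (assign to f)
    private
      P = wiredRawProcess D f
      module P = RawProcess P

    token-irrelevant : ∀ {s p} (a b : IsToken D s p) → a ≡ b
    token-irrelevant (initial a)  (initial b)    = cong initial (<-irrelevant a b)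
    token-irrelevant (output d a) (output d′ b) = cong₂ output (irrelevant d d′) (<-irrelevant a b)

    place-≡ : ∀ {s p} {a b : IsToken D s p} → _≡_ {A = Place D} (s , p , a) (s , p , b)
    place-≡ = cong (λ a → _ , _ , a) (token-irrelevant _ _)

    event-≡ : ∀ {t k} {a b : D t k} → _≡_ {A = Event D} (t , k , a) (t , k , b)
    event-≡ = cong (λ a → _ , _ , a) (irrelevant _ _)

    eventsOf-cover : ∀ σ {sub : ∀ {t k} → Occurs σ t k → D t k} {t k} {d : D t k} → Occurs σ t k →
                     (t , k , d) ∈ eventsOf σ sub
    eventsOf-cover (u ∷ σ) o with occurs-∷⁻ σ o
    ... | inj₁ o′            = there (eventsOf-cover σ o′)
    ... | inj₂ (refl , refl) = here event-≡

    input : ∀ {s t k j} → D t k → j < Fˢᵗ s t → IsToken D s (f s t k j)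
    input d j< with σ , σ! , o , sub ← support d = IsToken-mono sub (closed-token σ! o j<)

    Within : List T → P.S ⊎ P.T → Set ℓ
    Within σ (inj₁ (s , p , _)) = IsToken (Occurs σ) s p
    Within σ (inj₂ (t , k , _)) = Lift ℓ (Occurs σ t k)

    arc-within : ∀ {σ} → Closed f σ → ∀ x y → 0 < P.F x y → Within σ y → Within σ x
    arc-within σ! (inj₁ _) (inj₂ _) arc (lift o) with j , j< , refl ← χ-pos⁻ arc = closed-token σ! o j<
    arc-within σ! (inj₂ _) (inj₁ _) arc tok with j , refl ← χ-pos⁻ arc with output o _ ← tok = lift o

    path-within : ∀ {σ} → Closed f σ → ∀ {x y} → x P.F⁺ y → Within σ y → Within σ x
    path-within σ! [ arc ]               w = arc-within σ! _ _ arc w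
    path-within σ! (_∷_ {x} {y} arc path) w = arc-within σ! x y arc (path-within σ! path w)

    -- The latest event takes only tokens that existed before it, and `σ` contains their pasts. For
    -- a cycle this would put the firing numbered `count σ t` among those with smaller numbers.
    path-into-last : ∀ {σ t d} → Closed f (t ∷ σ) → ∀ {x} → x P.F⁺ inj₂ (t , count σ t , d) → Within σ x
    path-into-last (t! ∷ σ!) ([_] {inj₁ _} arc) with j , j< , refl ← χ-pos⁻ arc = t! j<
    path-into-last c@(_ ∷ σ!) (_∷_ {x} {y} arc path) = arc-within σ! x y arc (path-into-last c path)

    event-acyclic : ∀ {σ} → Closed f σ → ∀ {e} → Within σ (inj₂ e) → ¬ (inj₂ e P.F⁺ inj₂ e)
    event-acyclic c@(_∷_ {σ = σ} _ σ!) (lift o) cycle with occurs-∷⁻ σ o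
    ... | inj₁ o′            = event-acyclic σ! (lift o′) cycle
    ... | inj₂ (refl , refl) = <-irrefl refl (lower (path-into-last c cycle))

    consumer-unique : ∀ {p} {e e′ : P.T} → 0 < P.Fˢᵗ p e → 0 < P.Fˢᵗ p e′ → e ≡ e′
    consumer-unique {e = _ , _ , d} {_ , _ , d′} a a′
      with _ , j< , eq ← χ-pos⁻ a | _ , j<′ , eq′ ← χ-pos⁻ a′
      with refl ← injective d j< d′ j<′ (trans eq (sym eq′)) = event-≡

    producer-unique : ∀ {p} {e e′ : P.T} → 0 < P.Fᵗˢ e p → 0 < P.Fᵗˢ e′ p → e ≡ e′
    producer-unique {p} a a′ with _ , refl ← χ-pos⁻ a with _ , refl ← χ-pos⁻ a′ = event-≡

    wired-isGRProcess : IsGRProcess P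
    wired-isGRProcess = record
      { isNet = record
        { preset-finite = λ (t , k , d) → finite-family (proj₁ (N.preset-finite t)) (λ s → Fˢᵗ s t)
            (λ s j → s , f s t k (toℕ j) , input d (toℕ<n j))
            (λ {x} a → inputs-covered x a)
        ; preset-nonempty = λ (t , k , d) → let s , 0< = N.preset-nonempty t in
            (s , f s t k 0 , input d 0<) , χ-pos⁺ (0 , 0< , refl)
        ; postset-finite = λ (t , k , d) → finite-family (proj₁ (N.postset-finite t)) (Fᵗˢ t)
            (λ s j → s , inj₂ (t , k , toℕ j) , output d (toℕ<n j))
            (λ {x} a → outputs-covered x a)
        }
      ; preset-≤1 = λ p → unique⇒∣∣≤1 (λ _ → χ≤1 _) (producer-unique {p})
      ; postset-≤1 = λ p → unique⇒∣∣≤1 (λ _ → χ≤1 _) (consumer-unique {p})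
      ; M₀-initial = λ
        { (_ , _ , initial {i} _)  _     → χ-yes (i , refl)
        ; (_ , _ , output d _) empty → ⊥-elim (1+n≢0 (trans (sym (χ-yes (_ , refl))) (empty (_ , _ , d)))) }
      ; M₀-non-initial = λ
        { (_ , _ , initial _)  nonempty → ⊥-elim (nonempty (λ _ → χ-no λ ()))
        ; (_ , _ , output _ _) _        → χ-no λ () }
      ; acyclic = λ
        { (inj₂ (_ , _ , d))  cycle → let _ , σ! , o , _ = support d in event-acyclic σ! (lift o) cycle
        -- A cycle through a place is rotated so that it starts at the event consuming that place.
        ; (inj₁ _) (_∷_ {y = inj₂ (_ , _ , d)} arc path) →
            let _ , σ! , o , _ = support d in event-acyclic σ! (lift o) (path ∷ʳ arc) }
      ; finite-past = λ (t , k , d) → let σ , σ! , o , sub = support d in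
          eventsOf σ sub , λ path → eventsOf-cover σ (lower (path-within σ! path (lift o)))
      ; π-M₀ = λ s → enumerate⇒∣∣≐ (λ x → ⊓-≤1 (χ≤1 _))
          (λ i → s , inj₁ (toℕ i) , initial (toℕ<n i))
          (λ i → ⊓-pos⁺ (χ-pos⁺ refl) (χ-pos⁺ (_ , refl)))
          (λ eq → toℕ-injective (inj₁-injective′ eq))
          (λ {x} → initial-covered s x)
      ; π-preset = λ (t , k , d) s → enumerate⇒∣∣≐ (λ x → ⊓-≤1 (χ≤1 _))
          (λ j → s , f s t k (toℕ j) , input d (toℕ<n j))
          (λ j → ⊓-pos⁺ (χ-pos⁺ refl) (χ-pos⁺ (_ , toℕ<n j , refl)))
          (λ {i} {j} eq → toℕ-injective (index-≡ (injective d (toℕ<n i) d (toℕ<n j) (token-cong eq))))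
          (λ {x} a → input-covered t k d s x a)
      ; π-postset = λ (t , k , d) s → enumerate⇒∣∣≐ (λ x → ⊓-≤1 (χ≤1 _))
          (λ j → s , inj₂ (t , k , toℕ j) , output d (toℕ<n j))
          (λ j → ⊓-pos⁺ (χ-pos⁺ refl) (χ-pos⁺ (_ , refl)))
          (λ eq → toℕ-injective (inj₂-injective′ eq))
          (λ {x} → output-covered t k d s x)
      }
      where
      ⊓-≤1 : ∀ {m n} → m ≤ 1 → m ⊓ n ≤ 1
      ⊓-≤1 m≤1 = ≤-trans (m⊓n≤m _ _) m≤1

      place-cong : ∀ {s p q} {a : IsToken D s p} {b : IsToken D s q} → p ≡ q →
                   _≡_ {A = Place D} (s , p , a) (s , q , b)
      place-cong refl = place-≡

      token-cong : ∀ {s p q} {a : IsToken D s p} {b : IsToken D s q} →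
                   _≡_ {A = Place D} (s , p , a) (s , q , b) → p ≡ q
      token-cong refl = refl

      index-≡ : ∀ {t u : T} {k l i j : ℕ} → _≡_ {A = T × ℕ × ℕ} (t , k , i) (u , l , j) → i ≡ j
      index-≡ refl = refl

      inj₁-injective′ : ∀ {s i j} {a : IsToken D s (inj₁ i)} {b : IsToken D s (inj₁ j)} →
                        _≡_ {A = Place D} (s , inj₁ i , a) (s , inj₁ j , b) → i ≡ j
      inj₁-injective′ refl = refl

      inj₂-injective′ : ∀ {s t k i j} {a : IsToken D s (inj₂ (t , k , i))}
                        {b : IsToken D s (inj₂ (t , k , j))} →
                        _≡_ {A = Place D} (s , inj₂ (t , k , i) , a) (s , inj₂ (t , k , j) , b) → i ≡ j
      inj₂-injective′ refl = refl

      inputs-covered : ∀ {t k d} (x : Place D) → 0 < P.Fˢᵗ x (t , k , d) →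
        Σ[ s ∈ S ] s ∈ proj₁ (N.preset-finite t) ×
          Σ[ j ∈ Fin (Fˢᵗ s t) ] (s , f s t k (toℕ j) , input d (toℕ<n j)) ≡ x
      inputs-covered {t} {k} (s , _ , tok) a with j , j< , refl ← χ-pos⁻ a =
        s , proj₂ (N.preset-finite t) (≤-<-trans z≤n j<) , fromℕ< j< ,
        place-cong (cong (f s t k) (toℕ-fromℕ< j<))

      outputs-covered : ∀ {t k d} (x : Place D) → 0 < P.Fᵗˢ (t , k , d) x →
        Σ[ s ∈ S ] s ∈ proj₁ (N.postset-finite t) ×
          Σ[ j ∈ Fin (Fᵗˢ t s) ] (s , inj₂ (t , k , toℕ j) , output d (toℕ<n j)) ≡ x
      outputs-covered {t} (s , _ , tok) a with j , refl ← χ-pos⁻ a with output _ j< ← tok =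
        s , proj₂ (N.postset-finite t) (≤-<-trans z≤n j<) , fromℕ< j< ,
        place-cong (cong (λ i → inj₂ (_ , _ , i)) (toℕ-fromℕ< j<))

      initial-covered : ∀ s (x : Place D) → x ∈ₘ (P.πˢ ⁻¹⟨ s ⟩ ∩ₘ P.M₀) →
        ∃[ i ] (s , inj₁ (toℕ i) , initial (toℕ<n i)) ≡ x
      initial-covered s (_ , _ , tok) x∈ with refl ← χ-pos⁻ (proj₁ (⊓-pos⁻ x∈))
        with i , refl ← χ-pos⁻ (proj₂ (⊓-pos⁻ {χ (s ≡ s)} x∈)) with initial i< ← tok =
        fromℕ< i< , place-cong (cong inj₁ (toℕ-fromℕ< i<))

      input-covered : ∀ t k d s (x : Place D) → x ∈ₘ (P.πˢ ⁻¹⟨ s ⟩ ∩ₘ P.•ᵗ (t , k , d)) →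
        ∃[ j ] (s , f s t k (toℕ j) , input d (toℕ<n j)) ≡ x
      input-covered t k d s (_ , _ , tok) x∈ with refl ← χ-pos⁻ (proj₁ (⊓-pos⁻ x∈))
        with j , j< , refl ← χ-pos⁻ (proj₂ (⊓-pos⁻ {χ (s ≡ s)} x∈)) =
        fromℕ< j< , place-cong (cong (f s t k) (toℕ-fromℕ< j<))

      output-covered : ∀ t k d s (x : Place D) → x ∈ₘ (P.πˢ ⁻¹⟨ s ⟩ ∩ₘ (t , k , d) P.ᵗ•) →
        ∃[ j ] (s , inj₂ (t , k , toℕ j) , output d (toℕ<n j)) ≡ x
      output-covered t k d s (_ , _ , tok) x∈ with refl ← χ-pos⁻ (proj₁ (⊓-pos⁻ x∈))
        with j , refl ← χ-pos⁻ (proj₂ (⊓-pos⁻ {χ (s ≡ s)} x∈)) with output _ j< ← tok =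
        fromℕ< j< , place-cong (cong (λ i → inj₂ (t , k , i)) (toℕ-fromℕ< j<))

    process : GRProcess N
    process = record { rawProcess = P ; isGRProcess = wired-isGRProcess }

  -- Assignments and counting

  inclusion : ∀ {D D′} (W : Wiring D) (W′ : Wiring D′) → (∀ {t k} → D t k → D′ t k) →
              AgreeOn D (Wiring.assign W) (Wiring.assign W′) → process W ≼ process W′
  inclusion {D} W W′ D⊆D′ agree = record
    { ιˢ           = λ (s , p , tok) → s , p , IsToken-mono D⊆D′ tok
    ; ιᵗ           = λ (t , k , d) → t , k , D⊆D′ d
    ; ιˢ-injective = λ {x} {y} → place-injective {x} {y}
    ; ιᵗ-injective = λ {x} {y} → event-injective {x} {y}
    ; M₀-pres      = λ _ → refl
    ; M₀-covered   = covered
    ; Fˢᵗ-pres     = λ (s , p , _) (t , k , d) → χ-cong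
        (λ (j , j< , eq) → j , j< , trans (sym (agree d j<)) eq)
        (λ (j , j< , eq) → j , j< , trans (agree d j<) eq)
    ; Fᵗˢ-pres     = λ _ _ → refl
    ; πˢ-pres      = λ _ → refl
    ; πᵗ-pres      = λ _ → refl
    }
    where
    place-injective : ∀ {x y : Place D} →
      _≡_ {A = Place _} (proj₁ x , proj₁ (proj₂ x) , IsToken-mono D⊆D′ (proj₂ (proj₂ x)))
                        (proj₁ y , proj₁ (proj₂ y) , IsToken-mono D⊆D′ (proj₂ (proj₂ y))) → x ≡ y
    place-injective {s , p , a} {s′ , p′ , b} eq with cong proj₁ eq | cong (proj₁ ∘ proj₂) eq
    ... | refl | refl = place-≡ W

    event-injective : ∀ {x y : Event D} →
      _≡_ {A = Event _} (proj₁ x , proj₁ (proj₂ x) , D⊆D′ (proj₂ (proj₂ x)))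
                        (proj₁ y , proj₁ (proj₂ y) , D⊆D′ (proj₂ (proj₂ y))) → x ≡ y
    event-injective {t , k , d} {t′ , k′ , d′} eq with cong proj₁ eq | cong (proj₁ ∘ proj₂) eq
    ... | refl | refl = event-≡ W

    covered : ∀ x → 0 < χ (Initial (proj₁ (proj₂ x))) →
              ∃[ x′ ] (proj₁ x′ , proj₁ (proj₂ x′) , IsToken-mono D⊆D′ (proj₂ (proj₂ x′))) ≡ x
    covered (s , .(inj₁ _) , initial i<) _ = (s , _ , initial i<) , refl
    covered (s , .(inj₂ _) , output _ _) p with () ← proj₂ (χ-pos⁻ p)

  InjectiveOn-mono : ∀ {D D′ : T → ℕ → Set} {f} →
    (∀ {t k} → D t k → D′ t k) → InjectiveOn D′ f → InjectiveOn D f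
  InjectiveOn-mono D⊆D′ inj d j< d′ j<′ = inj (D⊆D′ d) j< (D⊆D′ d′) j<′

  InjectiveOn-cong : ∀ {D : T → ℕ → Set} {f g} → AgreeOn D f g → InjectiveOn D f → InjectiveOn D g
  InjectiveOn-cong f≈g inj d j< d′ j<′ eq =
    inj d j< d′ j<′ (trans (f≈g d j<) (trans eq (sym (f≈g d′ j<′))))

  closed-cong : ∀ {f g σ} → AgreeOn (Occurs σ) f g → Closed f σ → Closed g σ
  closed-cong f≈g [] = []
  closed-cong {σ = t ∷ σ} f≈g (t! ∷ σ!) =
    (λ j< → subst (IsToken _ _) (f≈g (occurs-here t σ) j<) (t! j<)) ∷
    closed-cong (λ o → f≈g (occurs-there σ o)) σ!

  closed-ʳ++⁻ : ∀ {f} α {σ} → Closed f (α ʳ++ σ) → Closed f σ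
  closed-ʳ++⁻ []      σ! = σ!
  closed-ʳ++⁻ (_ ∷ α) σ! with _ ∷ h ← closed-ʳ++⁻ α σ! = h

  -- The domain is given by `c` instead of `count σ`: exchanges preserve counts only pointwise, and
  -- events and places must keep their types while the linearisation varies.
  finiteWiring : ∀ {c f σ} → (∀ t → count σ t ≡ c t) → Closed f σ → InjectiveOn (Below c) f →
                 Wiring (Below c)
  finiteWiring {c} {f} {σ} eq σ! inj = record
    { irrelevant = <-irrelevant
    ; assign     = f
    ; injective  = inj
    ; support    = λ {t} k< → σ , σ! , subst (_ <_) (sym (eq t)) k< , λ {u} → subst (_ <_) (eq u)
    }

  finiteProcess-finite : ∀ {c} {W : Wiring (Below c)} σ →
    (∀ t → count σ t ≡ c t) → FiniteProcess (process W)
  finiteProcess-finite {c} {W} σ eq =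
    eventsOf σ (λ {t} → subst (_ <_) (eq t)) ,
    λ {(t , k , k<)} _ → eventsOf-cover W σ (subst (_ <_) (sym (eq t)) k<)

  -- All tokens ever put on `s`, whether taken since or not. Their number is the right side of
  -- `Enabled`; the slots number the tokens consumed on its left side.
  tokens : List T → S → List Token
  tokens []      s = map inj₁ (upTo (M₀ s))
  tokens (t ∷ σ) s = map (λ j → inj₂ (t , count σ t , j)) (upTo (Fᵗˢ t s)) ++ tokens σ s

  slots : List T → S → List (T × ℕ × ℕ)
  slots []      s = []
  slots (t ∷ σ) s = map (λ j → t , count σ t , j) (upTo (Fˢᵗ s t)) ++ slots σ s

  ∈-tokens⁺ : ∀ σ {s p} → IsToken (Occurs σ) s p → p ∈ tokens σ s
  ∈-tokens⁺ []      (initial i<)  = ∈-map⁺ inj₁ (∈-upTo⁺ i<)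
  ∈-tokens⁺ (t ∷ σ) {s} (initial i<) = ∈-++⁺ʳ (map _ (upTo (Fᵗˢ t s))) (∈-tokens⁺ σ (initial i<))
  ∈-tokens⁺ (t ∷ σ) {s} (output o j<) with occurs-∷⁻ σ o
  ... | inj₁ o′            = ∈-++⁺ʳ (map _ (upTo (Fᵗˢ t s))) (∈-tokens⁺ σ (output o′ j<))
  ... | inj₂ (refl , refl) = ∈-++⁺ˡ (∈-map⁺ _ (∈-upTo⁺ j<))

  ∈-tokens⁻ : ∀ σ {s p} → p ∈ tokens σ s → IsToken (Occurs σ) s p
  ∈-tokens⁻ [] p∈ with _ , i∈ , refl ← ∈-map⁻ inj₁ p∈ = initial (∈-upTo⁻ i∈)
  ∈-tokens⁻ (t ∷ σ) {s} p∈ with ∈-++⁻ (map _ (upTo (Fᵗˢ t s))) p∈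
  ... | inj₂ p∈′ = IsToken-mono (occurs-there σ) (∈-tokens⁻ σ p∈′)
  ... | inj₁ p∈′ with _ , j∈ , refl ← ∈-map⁻ (λ j → inj₂ (t , count σ t , j)) p∈′ =
    output (occurs-here t σ) (∈-upTo⁻ j∈)

  ∈-slots⁺ : ∀ σ {s t k j} → Occurs σ t k → j < Fˢᵗ s t → (t , k , j) ∈ slots σ s
  ∈-slots⁺ (u ∷ σ) {s} o j< with occurs-∷⁻ σ o
  ... | inj₁ o′            = ∈-++⁺ʳ (map _ (upTo (Fˢᵗ s u))) (∈-slots⁺ σ o′ j<)
  ... | inj₂ (refl , refl) = ∈-++⁺ˡ (∈-map⁺ _ (∈-upTo⁺ j<))

  ∈-slots⁻ : ∀ σ {s t k j} → (t , k , j) ∈ slots σ s → Occurs σ t k × j < Fˢᵗ s t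
  ∈-slots⁻ (u ∷ σ) {s} x∈ with ∈-++⁻ (map _ (upTo (Fˢᵗ s u))) x∈
  ... | inj₂ x∈′ = let o , j< = ∈-slots⁻ σ x∈′ in occurs-there σ o , j<
  ... | inj₁ x∈′ with _ , j∈ , refl ← ∈-map⁻ (λ j → u , count σ u , j) x∈′ =
    occurs-here u σ , ∈-upTo⁻ j∈

  tokens-unique : ∀ σ s → Unique (tokens σ s)
  tokens-unique []      s = map⁺ inj₁-injective (upTo⁺ _)
  tokens-unique (t ∷ σ) s = ++⁺ (map⁺ (λ { refl → refl }) (upTo⁺ _)) (tokens-unique σ s) disjoint
    where
    disjoint : ∀ {p} → ¬ (p ∈ map (λ j → inj₂ (t , count σ t , j)) (upTo (Fᵗˢ t s)) × p ∈ tokens σ s)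
    disjoint (p∈ , p∈σ) with _ , _ , refl ← ∈-map⁻ _ p∈ with output o _ ← ∈-tokens⁻ σ p∈σ = <-irrefl refl o

  slots-unique : ∀ σ s → Unique (slots σ s)
  slots-unique []      s = []
  slots-unique (t ∷ σ) s = ++⁺ (map⁺ (λ { refl → refl }) (upTo⁺ _)) (slots-unique σ s) disjoint
    where
    disjoint : ∀ {x} → ¬ (x ∈ map (λ j → t , count σ t , j) (upTo (Fˢᵗ s t)) × x ∈ slots σ s)
    disjoint (x∈ , x∈σ) with _ , _ , refl ← ∈-map⁻ _ x∈ = <-irrefl refl (proj₁ (∈-slots⁻ σ x∈σ))

  length-map-upTo : ∀ {a} {A : Set a} (g : ℕ → A) n → length (map g (upTo n)) ≡ n
  length-map-upTo g n = trans (length-map g (upTo n)) (length-upTo n)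

  length-tokens : ∀ σ s → length (tokens σ s) ≡ M₀ s + produced σ s
  length-tokens []      s = trans (length-map-upTo inj₁ _) (sym (+-identityʳ _))
  length-tokens (t ∷ σ) s = begin
    length (outputs ++ tokens σ s)
      ≡⟨ length-++ outputs ⟩
    length outputs + length (tokens σ s)
      ≡⟨ cong₂ _+_ (length-map-upTo (λ j → inj₂ (t , count σ t , j)) (Fᵗˢ t s)) (length-tokens σ s) ⟩
    Fᵗˢ t s + (M₀ s + produced σ s)
      ≡⟨ +-exchange (Fᵗˢ t s) (M₀ s) _ ⟩
    M₀ s + (Fᵗˢ t s + produced σ s) ∎
    where
    open ≡-Reasoning
    outputs : List Token
    outputs = map (λ j → inj₂ (t , count σ t , j)) (upTo (Fᵗˢ t s))

  length-slots : ∀ σ s → length (slots σ s) ≡ consumed σ s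
  length-slots []      s = refl
  length-slots (t ∷ σ) s = trans (length-++ (map _ (upTo (Fˢᵗ s t))))
    (cong₂ _+_ (length-map-upTo _ _) (length-slots σ s))

  inputSlots : T → List (S × ℕ)
  inputSlots t = concatMap (λ s → map (s ,_) (upTo (Fˢᵗ s t))) (proj₁ (N.preset-finite t))

  ∈-inputSlots : ∀ t {s j} → j < Fˢᵗ s t → (s , j) ∈ inputSlots t
  ∈-inputSlots t j< = ∈-concatMap⁺ (λ s → map (s ,_) (upTo (Fˢᵗ s t)))
    (lose (proj₂ (N.preset-finite t) (≤-<-trans z≤n j<)) (∈-map⁺ _ (∈-upTo⁺ j<)))

  -- Tokens are chosen among those available from `B` and must avoid those taken by `D`. The two
  -- differ when `t` has to ignore the outputs of a concurrent event and yet must not take its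
  -- inputs.
  record Choice (B D : T → ℕ → Set) (f : Assignment) (t : T) : Set ℓ where
    field
      pick      : S → ℕ → Token
      isToken   : ∀ {s j} → j < Fˢᵗ s t → IsToken B s (pick s j)
      fresh     : ∀ {s j u k i} → j < Fˢᵗ s t → D u k → i < Fˢᵗ s u → f s u k i ≢ pick s j
      injective : ∀ {s i j} → i < Fˢᵗ s t → j < Fˢᵗ s t → pick s i ≡ pick s j → i ≡ j

  -- At each place the supply from `b` exceeds what `τ` takes by at least the demand of `t`. Taken
  -- tokens outside the supply only leave more to choose from.
  choose : ∀ b τ {f t} → (∀ s → Fˢᵗ s t + consumed τ s ≤ M₀ s + produced b s) →
           Choice (Occurs b) (Occurs τ) f t
  choose b τ {f} {t} enough = record
    { pick      = λ s → proj₁ (picks s)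
    ; isToken   = λ {s} j< → ∈-tokens⁻ b (proj₁ (proj₁ (proj₂ (picks s)) j<))
    ; fresh     = λ {s} j< o i< eq → proj₂ (proj₁ (proj₂ (picks s)) j<)
                    (subst (_∈ taken s) eq (∈-map⁺ (takes s) (∈-slots⁺ τ o i<)))
    ; injective = λ {s} → proj₂ (proj₂ (picks s))
    }
    where
    takes : S → T × ℕ × ℕ → Token
    takes s (u , k , i) = f s u k i
    taken : S → List Token
    taken s = map (takes s) (slots τ s)
    picks : ∀ s → Σ[ d ∈ (ℕ → Token) ] (∀ {j} → j < Fˢᵗ s t → d j ∈ tokens b s × d j ∉ taken s) ×
                     (∀ {i j} → i < Fˢᵗ s t → j < Fˢᵗ s t → d i ≡ d j → i ≡ j)
    picks s = choose-outside _≟_ (inj₁ 0) (taken s) (Fˢᵗ s t) (tokens-unique b s)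
      (subst₂ (λ m n → Fˢᵗ s t + m ≤ n)
        (sym (trans (length-map (takes s) (slots τ s)) (length-slots τ s)))
        (sym (length-tokens b s)) (enough s))

  -- Converse of `choose`: the inputs already served and the new ones inject together into the
  -- tokens on `s`, and comparing lengths gives the inequality.
  choice⇒enabled : ∀ {σ f t} → Closed f σ → InjectiveOn (Occurs σ) f →
                   Choice (Occurs σ) (Occurs σ) f t → Enabled σ t
  choice⇒enabled {σ} {f} {t} σ! inj C s = subst₂ _≤_
    (trans (length-++ news) (cong₂ _+_ (length-map-upTo inj₁ _)
      (trans (length-map inj₂ (slots σ s)) (length-slots σ s))))
    (length-tokens σ s)
    (injection-length demand
      (++⁺ (map⁺ inj₁-injective (upTo⁺ _)) (map⁺ inj₂-injective (slots-unique σ s)) disjoint)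
      (λ x∈ → ∈-tokens⁺ σ (supplied x∈)) demand-injective)
    where
    open Choice C
    news olds : List (ℕ ⊎ T × ℕ × ℕ)
    news = map inj₁ (upTo (Fˢᵗ s t))
    olds = map inj₂ (slots σ s)

    demand : ℕ ⊎ T × ℕ × ℕ → Token
    demand (inj₁ j)           = pick s j
    demand (inj₂ (u , k , i)) = f s u k i

    data View : ℕ ⊎ T × ℕ × ℕ → Set ℓ where
      new : ∀ {j} → j < Fˢᵗ s t → View (inj₁ j)
      old : ∀ {u k i} → Occurs σ u k → i < Fˢᵗ s u → View (inj₂ (u , k , i))

    view : ∀ {x} → x ∈ news ++ olds → View x
    view x∈ with ∈-++⁻ news x∈
    ... | inj₁ x∈′ with _ , j∈ , refl ← ∈-map⁻ inj₁ x∈′ = new (∈-upTo⁻ j∈)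
    ... | inj₂ x∈′ with _ , y∈ , refl ← ∈-map⁻ inj₂ x∈′ = let o , i< = ∈-slots⁻ σ y∈ in old o i<

    disjoint : ∀ {x} → ¬ (x ∈ news × x ∈ olds)
    disjoint (x∈ , x∈′) with _ , _ , refl ← ∈-map⁻ inj₁ x∈ with () ← proj₂ (proj₂ (∈-map⁻ inj₂ x∈′))

    supplied : ∀ {x} → x ∈ news ++ olds → IsToken (Occurs σ) s (demand x)
    supplied x∈ with view x∈
    ... | new j<   = isToken j<
    ... | old o i< = closed-token σ! o i<

    demand-injective : ∀ {x y} → x ∈ news ++ olds → y ∈ news ++ olds → demand x ≡ demand y → x ≡ y
    demand-injective x∈ y∈ eq with view x∈ | view y∈
    ... | new j<   | new j<′    = cong inj₁ (injective j< j<′ eq)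
    ... | new j<   | old o i<   = ⊥-elim (fresh j< o i< (sym eq))
    ... | old o i< | new j<     = ⊥-elim (fresh j< o i< eq)
    ... | old o i< | old o′ i<′ = cong inj₂ (inj o i< o′ i<′ eq)

  closed⇒firable : ∀ {σ f} → Closed f σ → InjectiveOn (Occurs σ) f → Firable σ
  closed⇒firable [] _ = []
  closed⇒firable {t ∷ σ} {f} (t! ∷ σ!) inj =
    choice⇒enabled σ! inj′ (record
      { pick      = λ s j → f s t (count σ t) j
      ; isToken   = t!
      ; fresh     = λ j< o i< eq → fresh′ o (inj (occurs-there σ o) i< (occurs-here t σ) j< eq)
      ; injective = λ i< j< eq → index-≡ (inj (occurs-here t σ) i< (occurs-here t σ) j< eq)
      }) ∷ closed⇒firable σ! inj′
    where
    inj′ : InjectiveOn (Occurs σ) f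
    inj′ = InjectiveOn-mono {f = f} (occurs-there σ) inj
    fresh′ : ∀ {u k i j} → Occurs σ u k → _≡_ {A = T × ℕ × ℕ} (u , k , i) (t , count σ t , j) → ⊥
    fresh′ o refl = <-irrefl refl o
    index-≡ : ∀ {t u : T} {k l i j : ℕ} → _≡_ {A = T × ℕ × ℕ} (t , k , i) (u , l , j) → i ≡ j
    index-≡ refl = refl

  InjectiveOn-⊎ : ∀ {D D′ : T → ℕ → Set} {E : T → ℕ → Set ℓ} {f} →
    (∀ {t k} → D′ t k → D t k ⊎ E t k) → InjectiveOn D f → InjectiveOn E f →
    (∀ {s t k j u l i} → D t k → j < Fˢᵗ s t → E u l → i < Fˢᵗ s u → f s t k j ≢ f s u l i) →
    InjectiveOn D′ f
  InjectiveOn-⊎ split injD injE apart d j< d′ j<′ eq with split d | split d′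
  ... | inj₁ a | inj₁ b = injD a j< b j<′ eq
  ... | inj₂ a | inj₂ b = injE a j< b j<′ eq
  ... | inj₁ a | inj₂ b = ⊥-elim (apart a j< b j<′ eq)
  ... | inj₂ a | inj₁ b = ⊥-elim (apart b j<′ a j< (sym eq))

  record Extension (B : T → ℕ → Set) (f : Assignment) (τ : List T) (t : T) : Set ℓ where
    field
      assign    : Assignment
      agree     : AgreeOn (Occurs τ) f assign
      injective : InjectiveOn (Occurs (t ∷ τ)) assign
      isToken   : ∀ {s j} → j < Fˢᵗ s t → IsToken B s (assign s t (count τ t) j)

  extend : ∀ {B f τ t} → InjectiveOn (Occurs τ) f → Choice B (Occurs τ) f t → Extension B f τ t
  extend {B} {f} {τ} {t} inj C = record
    { assign    = g
    ; agree     = λ o _ → sym (g-old o)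
    ; injective = InjectiveOn-⊎ {E = New} {f = g} split
        (InjectiveOn-cong (λ o _ → sym (g-old o)) inj)
        (λ { refl j< refl j<′ eq → cong (λ j → t , count τ t , j)
               (C.injective j< j<′ (trans (sym g-new) (trans eq g-new))) })
        (λ { o j< refl i< eq → C.fresh i< o j< (trans (sym (g-old o)) (trans eq g-new)) })
    ; isToken   = λ j< → subst (IsToken B _) (sym g-new) (C.isToken j<)
    }
    where
    module C = Choice C
    New : T → ℕ → Set ℓ
    New u k = _≡_ {A = T × ℕ} (u , k) (t , count τ t)
    g : Assignment
    g s u k j = if does ((u , k) ≟ (t , count τ t)) then C.pick s j else f s u k j
    g-new : ∀ {s j} → g s t (count τ t) j ≡ C.pick s j
    g-new = if-yes ((t , count τ t) ≟ (t , count τ t)) refl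
    g-old : ∀ {s u k j} → Occurs τ u k → g s u k j ≡ f s u k j
    g-old {s} {u} {k} o = if-no ((u , k) ≟ (t , count τ t)) λ { refl → <-irrefl refl o }
    split : ∀ {u k} → Occurs (t ∷ τ) u k → Occurs τ u k ⊎ New u k
    split o with occurs-∷⁻ τ o
    ... | inj₁ o′            = inj₁ o′
    ... | inj₂ (refl , refl) = inj₂ refl

  -- Swapping tokens

  occurs-++ʳ : ∀ α {σ t k} → Occurs σ t k → Occurs (α ++ σ) t k
  occurs-++ʳ []      o = o
  occurs-++ʳ (u ∷ α) o = occurs-there (α ++ _) (occurs-++ʳ α o)

  below-resp : ∀ {c c′ : T → ℕ} → (∀ t → c t ≡ c′ t) → ∀ {t k} → Below c t k → Below c′ t k
  below-resp eq {t} = subst (_ <_) (eq t)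

  closed-extension : ∀ {B f τ t} (X : Extension B f τ t) → (∀ {u k} → B u k → Occurs τ u k) →
                     Closed f τ → Closed (Extension.assign X) (t ∷ τ)
  closed-extension X B⊆τ τ! = (λ j< → IsToken-mono B⊆τ (isToken j<)) ∷ closed-cong agree τ!
    where open Extension X

  extendAlong : ∀ α {σ f} → Firable (α ++ σ) → Closed f σ → InjectiveOn (Occurs σ) f →
    ∃[ g ] AgreeOn (Occurs σ) f g × Closed g (α ++ σ) × InjectiveOn (Occurs (α ++ σ)) g
  extendAlong []      _         σ! inj = _ , (λ _ _ → refl) , σ! , inj
  extendAlong (t ∷ α) {σ} (t! ∷ α!) σ! inj with g , f≈g , g! , g-inj ← extendAlong α α! σ! inj =
    X.assign , (λ o j< → trans (f≈g o j<) (X.agree (occurs-++ʳ α o) j<)) ,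
    closed-extension X id g! , X.injective
    where
    X = extend {f = g} g-inj (choose (α ++ σ) (α ++ σ) t!)
    module X = Extension X

  firable⇒assignment : ∀ {σ} → Firable σ → ∃[ f ] InjectiveOn (Occurs σ) f × Closed f σ
  firable⇒assignment []               = (λ _ _ _ _ → inj₁ 0) , (λ ()) , []
  firable⇒assignment (_∷_ {σ = σ} t! σ!) with f , f-inj , f! ← firable⇒assignment σ! =
    X.assign , X.injective , closed-extension X id f!
    where
    X = extend {f = f} f-inj (choose σ σ t!)
    module X = Extension X

  module _ (disjoint : ConcurrentlyDisjoint) where

    -- Both `u` and `t` choose among the tokens present after `σ`, with `t` avoiding the choice of
    -- `u`. Neither uses an output of the other, so either may fire first. Their occurrence numbers
    -- do not depend on the order because `t ≢ u`.
    common-assignment : ∀ {σ τ} → Swap σ τ → Firable σ →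
      ∃[ f ] InjectiveOn (Occurs σ) f × Closed f σ × Closed f τ
    common-assignment (here {t} {u} {σ} t≢u t! u!) (_ ∷ _ ∷ σ!) = X₂.assign , X₂.injective ,
      closed-extension X₂ (occurs-there σ) (closed-extension X₁ id f₀!) ,
      ((λ j< → subst (IsToken _ _) (agree-u j<) (IsToken-mono (occurs-there σ) (X₁.isToken j<))) ∷
       (λ {_} {j} j< → subst (λ k → IsToken (Occurs σ) _ (X₂.assign _ t k j)) (count-there σ (t≢u ∘ sym))
                         (X₂.isToken j<)) ∷
       closed-cong (λ o j< → trans (X₁.agree o j<) (X₂.agree (occurs-there σ o) j<)) f₀!)
      where
      f₀ = proj₁ (firable⇒assignment σ!)
      f₀-inj : InjectiveOn (Occurs σ) f₀
      f₀-inj = proj₁ (proj₂ (firable⇒assignment σ!))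
      f₀! : Closed f₀ σ
      f₀! = proj₂ (proj₂ (firable⇒assignment σ!))
      X₁ = extend {f = f₀} f₀-inj (choose σ σ u!)
      module X₁ = Extension X₁

      -- The outputs of `u` are left out on the right. Disjointness reduces each place to the demand
      -- of a single transition.
      enough : ∀ s → Fˢᵗ s t + (Fˢᵗ s u + consumed σ s) ≤ M₀ s + produced σ s
      enough s with disjoint σ! t! u! t≢u s
      ... | inj₁ t0 rewrite t0 = u! s
      ... | inj₂ u0 rewrite u0 = t! s

      X₂ = extend {f = X₁.assign} X₁.injective (choose σ (u ∷ σ) enough)
      module X₂ = Extension X₂

      agree-u : ∀ {s j} → j < Fˢᵗ s u →
        X₁.assign s u (count σ u) j ≡ X₂.assign s u (count (t ∷ σ) u) j
      agree-u {s} {j} j< = trans (X₂.agree (occurs-here u σ) j<)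
        (cong (λ k → X₂.assign s u k j) (sym (count-there σ t≢u)))
    common-assignment (there {v} {σ} {τ} p) (v! ∷ σ!) with f , inj , fσ! , fτ! ← common-assignment p σ! =
      X.assign , X.injective , closed-extension X id fσ! ,
      (λ {_} {j} j< → IsToken-mono (below-resp (swap-count p))
        (subst (λ k → IsToken (Occurs σ) _ (X.assign _ v k j)) (swap-count p v) (X.isToken j<))) ∷
      closed-cong (λ o → X.agree (below-resp (sym ∘ swap-count p) o)) fτ!
      where
      X = extend {f = f} inj (choose σ σ v!)
      module X = Extension X

  transpose : Token → Token → Token → Token
  transpose p q r = if does (r ≟ p) then q else if does (r ≟ q) then p else r

  transpose-fst : ∀ p q → transpose p q p ≡ q
  transpose-fst p q = if-yes (p ≟ p) refl

  transpose-snd : ∀ p q → transpose p q q ≡ p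
  transpose-snd p q with q ≟ p
  ... | yes refl = transpose-fst q q
  ... | no q≢p   = trans (if-no (q ≟ p) q≢p) (if-yes (q ≟ q) refl)

  transpose-other : ∀ {p q r} → r ≢ p → r ≢ q → transpose p q r ≡ r
  transpose-other r≢p r≢q = trans (if-no (_ ≟ _) r≢p) (if-no (_ ≟ _) r≢q)

  transpose-involutive : ∀ p q r → transpose p q (transpose p q r) ≡ r
  transpose-involutive p q r with r ≟ p
  ... | yes refl = trans (cong (transpose p q) (transpose-fst p q)) (transpose-snd p q)
  ... | no r≢p with r ≟ q
  ...   | yes refl = trans (cong (transpose p q) (transpose-snd p q)) (transpose-fst p q)
  ...   | no r≢q = trans (cong (transpose p q) (transpose-other r≢p r≢q)) (transpose-other r≢p r≢q)

  transpose-cases : ∀ p q r → transpose p q r ≡ r ⊎ transpose p q r ≡ p ⊎ transpose p q r ≡ q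
  transpose-cases p q r with r ≟ p
  ... | yes refl = inj₂ (inj₂ (transpose-fst p q))
  ... | no r≢p with r ≟ q
  ...   | yes refl = inj₂ (inj₁ (transpose-snd p q))
  ...   | no r≢q = inj₁ (transpose-other r≢p r≢q)

  transposeAt : S → Token → Token → Assignment → Assignment
  transposeAt s p q f s′ t k j = if does (s′ ≟ s) then transpose p q (f s′ t k j) else f s′ t k j

  transposeAt-here : ∀ {s p q f t k j} → transposeAt s p q f s t k j ≡ transpose p q (f s t k j)
  transposeAt-here {s} = if-yes (s ≟ s) refl

  transposeAt-there : ∀ {s p q f s′ t k j} → s′ ≢ s → transposeAt s p q f s′ t k j ≡ f s′ t k j
  transposeAt-there {s} {s′ = s′} = if-no (s′ ≟ s)

  transposeAt-injective : ∀ {D : T → ℕ → Set} {s p q f} →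
    InjectiveOn D f → InjectiveOn D (transposeAt s p q f)
  transposeAt-injective {s = s} {p} {q} {f} inj {s′} d j< d′ j<′ eq with s′ ≟ s
  ... | no s′≢s = inj d j< d′ j<′ (trans (sym (transposeAt-there {f = f} s′≢s))
    (trans eq (transposeAt-there {f = f} s′≢s)))
  ... | yes refl = inj d j< d′ j<′ (begin
    _                                            ≡⟨ transpose-involutive p q _ ⟨
    transpose p q (transpose p q (f s _ _ _))    ≡⟨ cong (transpose p q) (transposeAt-here {f = f}) ⟨
    transpose p q (transposeAt s p q f s _ _ _)  ≡⟨ cong (transpose p q) eq ⟩
    transpose p q (transposeAt s p q f s _ _ _)  ≡⟨ cong (transpose p q) (transposeAt-here {f = f}) ⟩
    transpose p q (transpose p q (f s _ _ _))    ≡⟨ transpose-involutive p q _ ⟩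
    _                                            ∎)
    where open ≡-Reasoning

  consumes-transposeAt : ∀ {f s p q t k} r →
    χ (Consumes (transposeAt s p q f) s t k r) ≡ χ (Consumes f s t k (transpose p q r))
  consumes-transposeAt {f} {s} {p} {q} {t} {k} r = χ-cong
    (λ (j , j< , eq) → j , j< , trans (sym (transpose-involutive p q _))
      (cong (transpose p q) (trans (sym (transposeAt-here {f = f})) eq)))
    (λ (j , j< , eq) → j , j< , trans (transposeAt-here {f = f})
      (trans (cong (transpose p q) eq) (transpose-involutive p q r)))

  -- Transposing two values of the assignment exchanges the consumers of the two places, so the
  -- carriers can be mapped identically.
  swap-≅ : ∀ {D s p q} (W W′ : Wiring D) (p! : IsToken D s p) (q! : IsToken D s q) →
    Wiring.assign W′ ≡ transposeAt s p q (Wiring.assign W) →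
    swap (GRProcess.rawProcess (process W)) (s , p , p!) (s , q , q!) ≅ GRProcess.rawProcess (process W′)
  swap-≅ {D} {s} {p} {q} W W′ p! q! refl = record
    { places      = ↔-id _
    ; transitions = ↔-id _
    ; M₀-pres     = λ _ → refl
    ; Fˢᵗ-pres    = pres
    ; Fᵗˢ-pres    = λ _ _ → refl
    ; πˢ-pres     = λ _ → refl
    ; πᵗ-pres     = λ _ → refl
    }
    where
    f = Wiring.assign W
    p̂ q̂ : Place D
    p̂ = s , p , p!
    q̂ = s , q , q!

    pres : ∀ x e →
      χ (Consumes (transposeAt s p q f) (proj₁ x) (proj₁ e) (proj₁ (proj₂ e)) (proj₁ (proj₂ x))) ≡
      RawProcess.Fˢᵗ (swap (GRProcess.rawProcess (process W)) p̂ q̂) x e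
    pres x@(s′ , r , tok) e with x ≟ p̂ | x ≟ q̂
    ... | yes refl | _ = trans (consumes-transposeAt {f} p)
      (trans (cong (λ r → χ (Consumes f s _ _ r)) (transpose-fst p q)) (sym (if-yes (x ≟ p̂) refl)))
    ... | no x≢p̂ | yes refl = trans (consumes-transposeAt {f} q)
      (trans (cong (λ r → χ (Consumes f s _ _ r)) (transpose-snd p q))
        (sym (trans (if-no (x ≟ p̂) x≢p̂) (if-yes (x ≟ q̂) refl))))
    ... | no x≢p̂ | no x≢q̂ = trans other (sym (trans (if-no (x ≟ p̂) x≢p̂) (if-no (x ≟ q̂) x≢q̂)))
      where
      other : χ (Consumes (transposeAt s p q f) s′ (proj₁ e) (proj₁ (proj₂ e)) r) ≡
              χ (Consumes f s′ (proj₁ e) (proj₁ (proj₂ e)) r)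
      other with s′ ≟ s
      ... | no s′≢s = χ-cong
        (λ (j , j< , eq) → j , j< , trans (sym (transposeAt-there {f = f} s′≢s)) eq)
        (λ (j , j< , eq) → j , j< , trans (transposeAt-there {f = f} s′≢s) eq)
      ... | yes refl = trans (consumes-transposeAt {f} r) (cong (λ r → χ (Consumes f s _ _ r))
        (transpose-other (λ { refl → x≢p̂ (place-≡ W) }) (λ { refl → x≢q̂ (place-≡ W) })))

  -- A token present after `b` may be named at any later firing, so changing values into such tokens
  -- can violate closedness only within `b`.
  closed-ʳ++ : ∀ {f f′} β {b} →
    (∀ s u i j → f′ s u i j ≡ f s u i j ⊎ IsToken (Occurs b) s (f′ s u i j)) →
    Closed f (β ʳ++ b) → Closed f′ b → Closed f′ (β ʳ++ b)
  closed-ʳ++ []      change σ! b! = b!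
  closed-ʳ++ {f} {f′} (t ∷ β) {b} change σ! b! = closed-ʳ++ β change′ σ! (head ∷ b!)
    where
    change′ : ∀ s u i j → f′ s u i j ≡ f s u i j ⊎ IsToken (Occurs (t ∷ b)) s (f′ s u i j)
    change′ s u i j with change s u i j
    ... | inj₁ eq  = inj₁ eq
    ... | inj₂ tok = inj₂ (IsToken-mono (occurs-there b) tok)
    head : ∀ {s j} → j < Fˢᵗ s t → IsToken (Occurs b) s (f′ s t (count b t) j)
    head {s} {j} j< with change s t (count b t) j
    ... | inj₂ tok = tok
    ... | inj₁ eq with t! ∷ _ ← closed-ʳ++⁻ β σ! = subst (IsToken _ s) (sym eq) (t! j<)

  discharge : ∀ {a b} {A : Set a} {P Q : Set b} {x y : A} {xs} →
              (P → Q) → (y ≡ x → Q) → P ⊎ y ∈ x ∷ xs → Q ⊎ y ∈ xs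
  discharge f g (inj₁ p)          = inj₁ (f p)
  discharge f g (inj₂ (here eq))  = inj₁ (g eq)
  discharge f g (inj₂ (there y∈)) = inj₂ y∈

  -- Alignment with a given assignment

  module _ {c : T → ℕ} {g : Assignment} (g-inj : InjectiveOn (Below c) g) where

    -- The occurrences in b already take the same tokens under W as under g,
    -- and (t , count b t) is the next one to be corrected.
    module _ (β : List T) (b : List T) (t : T) (c≗ : ∀ u → count (β ʳ++ (t ∷ b)) u ≡ c u)
             (g! : Closed g (β ʳ++ (t ∷ b))) where
      private
        k = count b t

        occurs⇒below : ∀ α {ρ u i} → Occurs ρ u i → Occurs (α ʳ++ ρ) u i
        occurs⇒below []      o = o
        occurs⇒below (v ∷ α) {ρ} o = occurs⇒below α (occurs-there ρ o)

        t-below : k < c t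
        t-below = below-resp c≗ (occurs⇒below β (occurs-here t b))

        b-below : ∀ {u i} → Occurs b u i → Below c u i
        b-below o = below-resp c≗ (occurs⇒below (t ∷ β) o)

      record Aligned (W : Wiring (Below c)) : Set ℓ where
        field
          closed : Closed (Wiring.assign W) (β ʳ++ (t ∷ b))
          agree  : AgreeOn (Occurs b) (Wiring.assign W) g

      Correct : Wiring (Below c) → S → ℕ → Set ℓ
      Correct W s j = Wiring.assign W s t k j ≡ g s t k j

      -- If the slot holds `p` where `g` prescribes `q`, both tokens exist after `b`, and
      -- transposing them corrects the slot. Later events remain closed because both tokens are
      -- available to them.
      correct-slot : ∀ W → Aligned W → ∀ {s j} → j < Fˢᵗ s t →
        Σ[ W′ ∈ Wiring (Below c) ] process W ≡₁* process W′ × Aligned W′ × Correct W′ s j ×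
                (∀ {s′ j′} → j′ < Fˢᵗ s′ t → Correct W s′ j′ → Correct W′ s′ j′)
      correct-slot W al {s} {j} j< with decide (Correct W s j)
      ... | yes ok = W , ε , al , ok , λ _ eq → eq
      ... | no p≢q =
        W′ ,
        (p̂ , q̂ , p↛q , q↛p , refl ,
          swap-≅ W W′ (IsToken-mono b-below p!) (IsToken-mono b-below q!) refl) ◅ ε ,
        record
          { closed = f′!
          ; agree  = λ o i< → trans (keep (b-below o) i< (agree o i<)) (agree o i<)
          } ,
        trans (transposeAt-here {f = f}) (transpose-fst p q) ,
        λ i< eq → trans (keep t-below i< eq) eq
        where
        open Aligned al
        f = Wiring.assign W
        f-inj = Wiring.injective W
        p q : Token
        p = f s t k j
        q = g s t k j
        f′ = transposeAt s p q f

        b! : Closed f b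
        b! with _ ∷ h ← closed-ʳ++⁻ β closed = h

        p! : IsToken (Occurs b) s p
        p! with h ∷ _ ← closed-ʳ++⁻ β closed = h j<

        q! : IsToken (Occurs b) s q
        q! with h ∷ _ ← closed-ʳ++⁻ β g! = h j<

        -- A slot that is already right holds neither token: `p` is held only by the slot under
        -- correction, as `f` is injective, and holding `q` would make `g` use `q` twice.
        keep : ∀ {s′ u i j′} → Below c u i → j′ < Fˢᵗ s′ u → f s′ u i j′ ≡ g s′ u i j′ →
               f′ s′ u i j′ ≡ f s′ u i j′
        keep {s′} d i< eq with s′ ≟ s
        ... | no s′≢s = transposeAt-there {f = f} s′≢s
        ... | yes refl = trans (transposeAt-here {f = f}) (transpose-other
          (λ eq′ → case-slot (f-inj d i< t-below j< eq′) eq)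
          (λ eq′ → case-slot (g-inj d i< t-below j< (trans (sym eq) eq′)) eq))
          where
          case-slot : ∀ {u i j′} → _≡_ {A = T × ℕ × ℕ} (u , i , j′) (t , k , j) →
                      f s u i j′ ≢ g s u i j′
          case-slot refl = p≢q

        change : ∀ s′ u i j′ → f′ s′ u i j′ ≡ f s′ u i j′ ⊎ IsToken (Occurs b) s′ (f′ s′ u i j′)
        change s′ u i j′ with s′ ≟ s
        ... | no s′≢s = inj₁ (transposeAt-there {f = f} s′≢s)
        ... | yes refl with transpose-cases p q (f s u i j′)
        ...   | inj₁ eq        = inj₁ (trans (transposeAt-here {f = f}) eq)
        ...   | inj₂ (inj₁ eq) = inj₂ (subst (IsToken _ s) (sym (trans (transposeAt-here {f = f}) eq)) p!)
        ...   | inj₂ (inj₂ eq) = inj₂ (subst (IsToken _ s) (sym (trans (transposeAt-here {f = f}) eq)) q!)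

        f′! : Closed f′ (β ʳ++ (t ∷ b))
        f′! = closed-ʳ++ (t ∷ β) change closed
          (closed-cong (λ o i< → sym (keep (b-below o) i< (agree o i<))) b!)

        W′ : Wiring (Below c)
        W′ = finiteWiring c≗ f′! (transposeAt-injective {f = f} f-inj)

        p̂ q̂ : Place (Below c)
        p̂ = s , p , IsToken-mono b-below p!
        q̂ = s , q , IsToken-mono b-below q!

        module P = GRProcess (process W)

        -- The consumer of `p` is `(t , k)`, which lies outside `b`, while the past of `q` lies
        -- inside.
        p↛q : ¬ (inj₁ p̂ P.F⁺ inj₁ q̂)
        p↛q (_∷_ {y = inj₂ (u , i , d)} arc path) with i′ , i< , eq ← χ-pos⁻ arc =
          absurd (f-inj d i< t-below j< eq) (lower (path-within W b! path q!))
          where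
          absurd : ∀ {u i i′} → _≡_ {A = T × ℕ × ℕ} (u , i , i′) (t , k , j) → ¬ Occurs b u i
          absurd refl = <-irrefl refl

        -- A consumer of `q` in the past of `p` would lie in `b`, where `f` agrees with `g`; but `g`
        -- gives `q` to `(t , k)`.
        q↛p : ¬ (inj₁ q̂ P.F⁺ inj₁ p̂)
        q↛p (_∷_ {y = inj₂ (u , i , d)} arc path) with i′ , i< , eq ← χ-pos⁻ arc =
          absurd o (g-inj d i< t-below j< (trans (sym (agree o i<)) eq))
          where
          o : Occurs b u i
          o = lower (path-within W b! path p!)
          absurd : ∀ {u i i′} → Occurs b u i → _≢_ {A = T × ℕ × ℕ} (u , i , i′) (t , k , j)
          absurd o refl = <-irrefl refl o

      correct-slots : ∀ xs W → Aligned W →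
        (∀ {s j} → j < Fˢᵗ s t → Correct W s j ⊎ (s , j) ∈ xs) →
        Σ[ W′ ∈ Wiring (Below c) ] process W ≡₁* process W′ × Aligned W′ ×
          (∀ {s j} → j < Fˢᵗ s t → Correct W′ s j)
      correct-slots [] W al done = W , ε , al , λ j< → [ id , (λ ()) ]′ (done j<)
      correct-slots ((s , j) ∷ xs) W al done with j <? Fˢᵗ s t
      ... | no j≮ = correct-slots xs W al λ i< →
        discharge id (λ { refl → ⊥-elim (j≮ i<) }) (done i<)
      ... | yes j< with W₁ , W→W₁ , al₁ , ok , keep ← correct-slot W al j<
        with W₂ , W₁→W₂ , al₂ , all ← correct-slots xs W₁ al₁
               (λ i< → discharge (keep i<) (λ { refl → ok }) (done i<)) =
        W₂ , W→W₁ ◅◅ W₁→W₂ , al₂ , all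

      correct-occurrence : ∀ W → Aligned W →
        Σ[ W′ ∈ Wiring (Below c) ] process W ≡₁* process W′ × Closed (Wiring.assign W′) (β ʳ++ (t ∷ b)) ×
                AgreeOn (Occurs (t ∷ b)) (Wiring.assign W′) g
      correct-occurrence W al
        with W′ , W→W′ , al′ , ok ← correct-slots (inputSlots t) W al
               (λ j< → inj₂ (∈-inputSlots t j<)) =
        W′ , W→W′ , Aligned.closed al′ , agree′
        where
        agree′ : AgreeOn (Occurs (t ∷ b)) (Wiring.assign W′) g
        agree′ o j< with occurs-∷⁻ b o
        ... | inj₁ o′            = Aligned.agree al′ o′ j<
        ... | inj₂ (refl , refl) = ok j<

    align : ∀ β b (W : Wiring (Below c)) → (∀ u → count (β ʳ++ b) u ≡ c u) →
      Closed (Wiring.assign W) (β ʳ++ b) → Closed g (β ʳ++ b) → AgreeOn (Occurs b) (Wiring.assign W) g →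
      Σ[ W′ ∈ Wiring (Below c) ] process W ≡₁* process W′ × AgreeOn (Below c) (Wiring.assign W′) g
    align []      b W c≗ _  _  agree = W , ε , λ d → agree (below-resp (sym ∘ c≗) d)
    align (t ∷ β) b W c≗ f! g! agree
      = let W₁ , W→W₁ , f₁! , agree₁ =
              correct-occurrence β b t c≗ g! W (record { closed = f! ; agree = agree })
            W₂ , W₁→W₂ , agree₂ = align β (t ∷ b) W₁ c≗ f₁! g! agree₁ in
        W₂ , W→W₁ ◅◅ W₁→W₂ , agree₂

    align-closed : ∀ {σ} (W : Wiring (Below c)) → (∀ u → count σ u ≡ c u) →
      Closed (Wiring.assign W) σ → Closed g σ →
      Σ[ W′ ∈ Wiring (Below c) ] process W ≡₁* process W′ × AgreeOn (Below c) (Wiring.assign W′) g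
    align-closed {σ} W c≗ f! g! = align (reverse σ) [] W
      (λ u → trans (cong (λ ρ → count ρ u) (reverse-involutive σ)) (c≗ u))
      (subst (Closed _) (sym (reverse-involutive σ)) f!)
      (subst (Closed g) (sym (reverse-involutive σ)) g!) (λ ())

  module _ (disjoint : ConcurrentlyDisjoint) where
    open Persistence disjoint

    align-≋ : ∀ {c g σ τ} → InjectiveOn (Below c) g → σ ≋ τ → Firable σ → (∀ u → count σ u ≡ c u) →
      (W : Wiring (Below c)) → Closed (Wiring.assign W) σ → Closed g τ →
      Σ[ W′ ∈ Wiring (Below c) ] process W ≡₁* process W′ × AgreeOn (Below c) (Wiring.assign W′) g
    align-≋ g-inj ε        σ! c≗ W f! g! = align-closed g-inj W c≗ f! g!
    align-≋ {c} g-inj (p ◅ ps) σ! c≗ W f! g!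
      with h , h-inj , hσ! , hσ′! ← common-assignment disjoint p σ!
      with W₁ , W→W₁ , agree₁ ← align-closed
             (InjectiveOn-mono {f = h} (below-resp (sym ∘ c≗)) h-inj) W c≗ f! hσ!
      with W₂ , W₁→W₂ , agree₂ ← align-≋ g-inj ps (swap-firable p σ!)
             (λ u → trans (sym (swap-count p u)) (c≗ u)) W₁
             (closed-cong (λ o j< → sym (agree₁
                (below-resp c≗ (below-resp (sym ∘ swap-count p) o)) j<)) hσ′!) g! =
      W₂ , W→W₁ ◅◅ W₁→W₂ , agree₂

  -- Naming the events and places of a finite process

  output-injective : ∀ {t t′ k k′ m n} → _≡_ {A = Token} (inj₂ (t , k , m)) (inj₂ (t′ , k′ , n)) →
                     t ≡ t′ × k ≡ k′ × m ≡ n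
  output-injective refl = refl , refl , refl

  χ-unique : ∀ {n A} → n ≤ 1 → (0 < n → A) → (A → 0 < n) → n ≡ χ A
  χ-unique {zero}  n≤1        f g = sym (χ-no λ a → n≮0 (g a))
  χ-unique {suc n} (s≤s z≤n) f g = sym (χ-yes (f (s≤s z≤n)))

  χ-mono : ∀ {A B} → (A → B) → χ A ≤ χ B
  χ-mono {A} f with decide A
  ... | yes a = subst₂ _≤_ (sym (χ-yes a)) (sym (χ-yes (f a))) ≤-refl
  ... | no ¬a = subst (_≤ _) (sym (χ-no ¬a)) z≤n

  module _ {X : Set ℓ} where

    census : (X → Set ℓ) → List X → ℕ
    census P []       = 0
    census P (x ∷ xs) = χ (P x) + census P xs

    census-≤ : ∀ {P Q} xs → (∀ {x} → P x → Q x) → census P xs ≤ census Q xs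
    census-≤ []       P⊆Q = z≤n
    census-≤ (x ∷ xs) P⊆Q = +-mono-≤ (χ-mono P⊆Q) (census-≤ xs P⊆Q)

    census-< : ∀ {P Q z} xs → (∀ {x} → P x → Q x) → z ∈ xs → Q z → ¬ P z → census P xs < census Q xs
    census-< (x ∷ xs) P⊆Q (here refl) Qz ¬Pz =
      subst₂ (λ m n → m + census _ xs < n + census _ xs) (sym (χ-no ¬Pz)) (sym (χ-yes Qz))
        (s≤s (census-≤ xs P⊆Q))
    census-< (x ∷ xs) P⊆Q (there z∈) Qz ¬Pz = +-mono-≤-< (χ-mono P⊆Q) (census-< xs P⊆Q z∈ Qz ¬Pz)

  module _ (Q : GRProcess N) (finite : FiniteProcess Q) where
    private module Q = GRProcess Q

    _≺_ : Q.T → Q.T → Set ℓ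
    e ≺ e′ = inj₂ e Q.F⁺ inj₂ e′

    data Topological : List Q.T → Set ℓ where
      []  : Topological []
      _∷_ : ∀ {e es} → e ∉ es × (∀ {e′} → e′ ≺ e → e′ ∈ es) → Topological es → Topological (e ∷ es)

    topological⇒unique : ∀ {es} → Topological es → Unique es
    topological⇒unique []                = []
    topological⇒unique ((e∉ , _) ∷ es!) =
      All.tabulate (λ { x∈ refl → e∉ x∈ }) ∷ topological⇒unique es!

    -- Repetitions in the covering list are counted too, but only strict growth along `≺` matters.
    -- It holds because an event precedes its successors and, by acyclicity, not itself.
    height : Q.T → ℕ
    height e = census (_≺ e) (proj₁ finite)

    height-< : ∀ {e e′} → e ≺ e′ → height e < height e′
    height-< {e} e≺e′ = census-< (proj₁ finite) (Plus._++ e≺e′) (proj₂ finite _) e≺e′ (Q.acyclic (inj₂ e))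

    -- Predecessors have smaller height, so they can be inserted first.
    insert : ∀ h {es} e → height e < h → Topological es →
             ∃[ es′ ] Topological es′ × (∀ {x} → x ∈ es → x ∈ es′) × e ∈ es′
    insert-past : ∀ h {es} xs e → height e ≤ h → Topological es →
             ∃[ es′ ] Topological es′ × (∀ {x} → x ∈ es → x ∈ es′) ×
                      (∀ {x} → x ∈ xs → x ≺ e → x ∈ es′)
    insert (suc h) e (s≤s e≤h) es!
      with es₁ , es₁! , ⊆es₁ , past ← insert-past h (proj₁ (Q.finite-past e)) e e≤h es!
      with decide (e ∈ es₁)
    ... | yes e∈ = es₁ , es₁! , ⊆es₁ , e∈
    ... | no  e∉ = e ∷ es₁ , (e∉ , λ p → past (proj₂ (Q.finite-past e) p) p) ∷ es₁! , there ∘ ⊆es₁ , here refl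
    insert-past h []       e e≤h es! = _ , es! , id , λ ()
    insert-past h (x ∷ xs) e e≤h es! with decide (x ≺ e)
    -- A list covering the past may contain events that do not precede `e`. They are skipped, since
    -- nothing bounds their height.
    ... | no x⊀e with es₁ , es₁! , ⊆es₁ , past ← insert-past h xs e e≤h es! =
      es₁ , es₁! , ⊆es₁ , λ { (here refl) p → ⊥-elim (x⊀e p) ; (there x∈) → past x∈ }
    ... | yes x≺e with es₁ , es₁! , ⊆es₁ , x∈es₁ ← insert h x (<-≤-trans (height-< x≺e) e≤h) es!
      with es₂ , es₂! , ⊆es₂ , past ← insert-past h xs e e≤h es₁! =
      es₂ , es₂! , ⊆es₂ ∘ ⊆es₁ , λ { (here refl) _ → ⊆es₂ x∈es₁ ; (there x∈) → past x∈ }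

    insert-all : ∀ xs → ∃[ es ] Topological es × (∀ {x} → x ∈ xs → x ∈ es)
    insert-all []       = [] , [] , λ ()
    insert-all (x ∷ xs) with es , es! , ⊆es ← insert-all xs
      with es₁ , es₁! , ⊆es₁ , x∈ ← insert (suc (height x)) x ≤-refl es! =
      es₁ , es₁! , λ { (here refl) → x∈ ; (there y∈) → ⊆es₁ (⊆es y∈) }

    private
      sorted = insert-all (proj₁ finite)
      es = proj₁ sorted
      es! = proj₁ (proj₂ sorted)

      member : ∀ e → e ∈ es
      member e = proj₂ (proj₂ sorted) (proj₂ finite _)

    index : ∀ {e zs} → e ∈ zs → ℕ
    index (here {x = e} {xs = zs} _) = count (map Q.πᵗ zs) (Q.πᵗ e)
    index (there e∈)                 = index e∈

    index-occurs : ∀ {e zs} (e∈ : e ∈ zs) → Occurs (map Q.πᵗ zs) (Q.πᵗ e) (index e∈)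
    index-occurs {e} {_ ∷ zs} (here refl) = occurs-here (Q.πᵗ e) (map Q.πᵗ zs)
    index-occurs {e} {_ ∷ zs} (there e∈)  = occurs-there (map Q.πᵗ zs) (index-occurs e∈)

    index-injective : ∀ {e e′ zs} (e∈ : e ∈ zs) (e′∈ : e′ ∈ zs) → Q.πᵗ e ≡ Q.πᵗ e′ →
                      index e∈ ≡ index e′∈ → e ≡ e′
    index-injective (here refl) (here refl) _  _  = refl
    index-injective (there e∈)  (there e′∈) eq eqᵢ = index-injective e∈ e′∈ eq eqᵢ
    index-injective {zs = _ ∷ zs} (here refl) (there e′∈) eq eqᵢ =
      ⊥-elim (<-irrefl (sym eqᵢ) (subst (λ t → index e′∈ < count (map Q.πᵗ zs) t) (sym eq) (index-occurs e′∈)))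
    index-injective {zs = _ ∷ zs} (there e∈) (here refl) eq eqᵢ =
      ⊥-elim (<-irrefl eqᵢ (subst (λ t → index e∈ < count (map Q.πᵗ zs) t) eq (index-occurs e∈)))

    occurs⇒event : ∀ zs {t k} → Occurs (map Q.πᵗ zs) t k →
                   ∃[ e ] Σ[ e∈ ∈ e ∈ zs ] Q.πᵗ e ≡ t × index e∈ ≡ k
    occurs⇒event (e ∷ zs) o with occurs-∷⁻ (map Q.πᵗ zs) o
    ... | inj₂ (refl , refl) = e , here refl , refl , refl
    ... | inj₁ o′ with e′ , e′∈ , eq , eqᵢ ← occurs⇒event zs o′ = e′ , there e′∈ , eq , eqᵢ

    number : Q.T → ℕ
    number e = index (member e)

    index≡number : ∀ {e} (e∈ : e ∈ es) → index e∈ ≡ number e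
    index≡number e∈ = cong index (unique⇒irrelevant (topological⇒unique es!) e∈ (member _))

    number-injective : ∀ {e e′} → Q.πᵗ e ≡ Q.πᵗ e′ → number e ≡ number e′ → e ≡ e′
    number-injective = index-injective (member _) (member _)

    record Enumeration (A : Multiset Q.S) (s : S) (n : ℕ) : Set ℓ where
      field
        item       : Fin n → Q.S
        label      : ∀ i → Q.πˢ (item i) ≡ s
        item∈      : ∀ i → item i ∈ₘ A
        injective  : Injective _≡_ _≡_ item
        surjective : ∀ {p} → Q.πˢ p ≡ s → p ∈ₘ A → ∃[ i ] item i ≡ p

    enumeration : ∀ {A s n} → ∣ Q.πˢ ⁻¹⟨ s ⟩ ∩ₘ A ∣≐ n → Enumeration A s n
    enumeration {A} {s} h with g , g∈ , g-inj , g-surj ←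
        ∣∣≐⇒enumerate (λ x → ≤-trans (m⊓n≤m _ _) (χ≤1 _)) h = record
      { item       = g
      ; label      = λ i → sym (χ-pos⁻ (proj₁ (⊓-pos⁻ (g∈ i))))
      ; item∈      = λ i → proj₂ (⊓-pos⁻ {χ (s ≡ Q.πˢ (g i))} (g∈ i))
      ; injective  = g-inj
      ; surjective = λ eq p∈ → g-surj (⊓-pos⁺ (χ-pos⁺ (sym eq)) p∈)
      }

    module Init s   = Enumeration (enumeration (Q.π-M₀ s))
    module Pre  e s = Enumeration (enumeration (Q.π-preset e s))
    module Post e s = Enumeration (enumeration (Q.π-postset e s))

    -- A relation, so that proofs about a given producer can build and invert namings, whereas
    -- `name` goes through a decision. Uniqueness of names rests on a place having either an initial
    -- token or a producer, never both, and at most one producer.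
    data Named (p : Q.S) (x : Token) : Set ℓ where
      initial : ∀ i → Init.item (Q.πˢ p) i ≡ p → x ≡ inj₁ (toℕ i) → Named p x
      output  : ∀ e i → Post.item e (Q.πˢ p) i ≡ p → x ≡ inj₂ (Q.πᵗ e , number e , toℕ i) → Named p x

    Produced : Q.S → Set ℓ
    Produced p = ∃[ e ] 0 < Q.Fᵗˢ e p

    ¬produced⇒M₀ : ∀ {p} → ¬ Produced p → Q.M₀ p ≡ 1
    ¬produced⇒M₀ {p} ¬prod = Q.M₀-initial p λ e → n≤0⇒n≡0 (≮⇒≥ (λ 0< → ¬prod (e , 0<)))

    produced⇒M₀ : ∀ {p} → Produced p → Q.M₀ p ≡ 0
    produced⇒M₀ {p} (e , 0<) = Q.M₀-non-initial p λ empty → <-irrefl (sym (empty e)) 0<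

    M₀≤1 : ∀ p → Q.M₀ p ≤ 1
    M₀≤1 p with decide (Produced p)
    ... | yes prod = subst (_≤ 1) (sym (produced⇒M₀ prod)) z≤n
    ... | no ¬prod = ≤-reflexive (¬produced⇒M₀ ¬prod)

    named-total : ∀ p → ∃[ x ] Named p x
    named-total p with decide (Produced p)
    ... | yes (e , 0<) with i , eq ← Post.surjective e (Q.πˢ p) refl 0< = _ , output e i eq refl
    ... | no ¬prod with i , eq ← Init.surjective (Q.πˢ p) refl
                          (subst (0 <_) (sym (¬produced⇒M₀ ¬prod)) (s≤s z≤n)) = _ , initial i eq refl

    initial⇒M₀ : ∀ {p i} → Init.item (Q.πˢ p) i ≡ p → 0 < Q.M₀ p
    initial⇒M₀ {p} {i} eq = subst (_∈ₘ Q.M₀) eq (Init.item∈ (Q.πˢ p) i)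

    output⇒F : ∀ {e p i} → Post.item e (Q.πˢ p) i ≡ p → 0 < Q.Fᵗˢ e p
    output⇒F {e} {p} {i} eq = subst (_∈ₘ (e Q.ᵗ•)) eq (Post.item∈ e (Q.πˢ p) i)

    named-functional : ∀ {p x y} → Named p x → Named p y → x ≡ y
    named-functional {p} (initial i eq refl) (initial j eq′ refl) =
      cong (inj₁ ∘ toℕ) (Init.injective (Q.πˢ p) (trans eq (sym eq′)))
    named-functional (initial i eq _) (output e j eq′ _) =
      ⊥-elim (<-irrefl (sym (produced⇒M₀ (e , output⇒F eq′))) (initial⇒M₀ eq))
    named-functional (output e j eq′ _) (initial i eq _) =
      ⊥-elim (<-irrefl (sym (produced⇒M₀ (e , output⇒F eq′))) (initial⇒M₀ eq))
    named-functional {p} (output e i eq refl) (output e′ j eq′ refl)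
      with refl ← ∣∣≤1⇒unique (Q.preset-≤1 p) (output⇒F eq) (output⇒F eq′) =
      cong (λ i → inj₂ (_ , _ , toℕ i)) (Post.injective e (Q.πˢ p) (trans eq (sym eq′)))

    named-injective : ∀ {p q x} → Named p x → Named q x → Q.πˢ p ≡ Q.πˢ q → p ≡ q
    named-injective {p} {q} (initial i eq refl) (initial j eq′ eqₓ) πeq =
      trans (sym eq) (trans (item-cong πeq (inj₁-inj eqₓ)) eq′)
      where
      inj₁-inj : ∀ {m n : ℕ} → _≡_ {A = Token} (inj₁ m) (inj₁ n) → m ≡ n
      inj₁-inj refl = refl
      item-cong : ∀ {s s′} {i : Fin (M₀ s)} {j : Fin (M₀ s′)} → s ≡ s′ → toℕ i ≡ toℕ j →
                  Init.item s i ≡ Init.item s′ j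
      item-cong refl eq = cong (Init.item _) (toℕ-injective eq)
    named-injective (initial _ _ refl) (output _ _ _ ()) _
    named-injective (output _ _ _ refl) (initial _ _ ()) _
    named-injective {p} {q} (output e i eq refl) (output e′ j eq′ eqₓ) πeq
      with πᵗ≡ , number≡ , i≡j ← output-injective eqₓ =
      trans (sym eq) (trans (item-cong (number-injective πᵗ≡ number≡) πeq i≡j) eq′)
      where
      item-cong : ∀ {e e′ s s′} {i : Fin (Fᵗˢ (Q.πᵗ e) s)} {j : Fin (Fᵗˢ (Q.πᵗ e′) s′)} →
                  e ≡ e′ → s ≡ s′ → toℕ i ≡ toℕ j → Post.item e s i ≡ Post.item e′ s′ j
      item-cong refl refl eq = cong (Post.item _ _) (toℕ-injective eq)

    name : Q.S → Token
    name p = proj₁ (named-total p)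

    name-named : ∀ p → Named p (name p)
    name-named p = proj₂ (named-total p)

    name-injective : ∀ {p q} → name p ≡ name q → Q.πˢ p ≡ Q.πˢ q → p ≡ q
    name-injective {p} {q} eq = named-injective (name-named p) (subst (Named q) (sym eq) (name-named q))

    σQ : List T
    σQ = map Q.πᵗ es

    -- Leads from bare numbers back to an event of `Q` and one of its inputs. The equations are
    -- needed since the bound on the position depends on the event found.
    record Slot (s : S) (t : T) (k j : ℕ) : Set ℓ where
      constructor slot
      field
        {event}  : Q.T
        position : Fin (Fˢᵗ s (Q.πᵗ event))
        event≡   : Q.πᵗ event ≡ t
        number≡  : number event ≡ k
        toℕ≡     : toℕ position ≡ j
      place : Q.S
      place = Pre.item event s position
    open Slot using (place)

    place-functional : ∀ {s t k j} (x y : Slot s t k j) → place x ≡ place y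
    place-functional (slot i refl refl refl) (slot i′ eq eqₙ eq′)
      with refl ← number-injective eq eqₙ with refl ← toℕ-injective eq′ = refl

    assignQ : Assignment
    assignQ s t k j = at (decide (Slot s t k j))
      where
      at : Dec (Slot s t k j) → Token
      at (yes x) = name (place x)
      at (no _)  = inj₁ 0

    assignQ-slot : ∀ {s t k j} (x : Slot s t k j) → assignQ s t k j ≡ name (place x)
    assignQ-slot {s} {t} {k} {j} x with em {Lift _ (Slot s t k j)}
    ... | yes (lift y) = cong name (place-functional y x)
    ... | no ¬x        = ⊥-elim (¬x (lift x))

    slot-of : ∀ {s t k j} → Occurs σQ t k → j < Fˢᵗ s t → Slot s t k j
    slot-of o j< with e , e∈ , refl , refl ← occurs⇒event es o =
      slot (fromℕ< j<) refl (sym (index≡number e∈)) (toℕ-fromℕ< j<)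

    place-label : ∀ {s t k j} (x : Slot s t k j) → Q.πˢ (place x) ≡ s
    place-label {s} x = Pre.label _ s (Slot.position x)

    place-F : ∀ {s t k j} (x : Slot s t k j) → 0 < Q.Fˢᵗ (place x) (Slot.event x)
    place-F {s} x = Pre.item∈ _ s (Slot.position x)

    slot-injective : ∀ {s t k j t′ k′ j′} (x : Slot s t k j) (y : Slot s t′ k′ j′) → place x ≡ place y →
                     _≡_ {A = T × ℕ × ℕ} (t , k , j) (t′ , k′ , j′)
    slot-injective {s} x@(slot {e} i refl refl refl) y@(slot {e′} i′ refl refl refl) eq
      with refl ← ∣∣≤1⇒unique (Q.postset-≤1 (place x)) {e} {e′} (place-F x)
                    (subst (λ p → 0 < Q.Fˢᵗ p e′) (sym eq) (place-F y)) =
      cong (λ i → _ , _ , toℕ i) (Pre.injective e s eq)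

    assignQ-injective : InjectiveOn (Occurs σQ) assignQ
    assignQ-injective o j< o′ j<′ eq = slot-injective x y (name-injective
      (trans (sym (assignQ-slot x)) (trans eq (assignQ-slot y)))
      (trans (place-label x) (sym (place-label y))))
      where
      x = slot-of o j<
      y = slot-of o′ j<′

    named-isToken : ∀ {D : T → ℕ → Set} {p x} → Named p x →
      (∀ {e} → 0 < Q.Fᵗˢ e p → D (Q.πᵗ e) (number e)) →
                    IsToken D (Q.πˢ p) x
    named-isToken (initial i _ refl)   _ = initial (toℕ<n i)
    named-isToken (output e i eq refl) d = output (d (output⇒F eq)) (toℕ<n i)

    -- `number` refers to the whole list `es`, whereas closedness counts within its tails. The map
    -- `ι` and the equation on indices express that passing to a tail does not renumber events.
    assignQ-closed′ : ∀ zs → Topological zs → (ι : ∀ {e} → e ∈ zs → e ∈ es) →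
      (∀ {e} (e∈ : e ∈ zs) → index (ι e∈) ≡ index e∈) → Closed assignQ (map Q.πᵗ zs)
    assignQ-closed′ []       []                _ _    = []
    assignQ-closed′ (e ∷ zs) ((_ , past) ∷ zs!) ι index≡ =
      head ∷ assignQ-closed′ zs zs! (ι ∘ there) (index≡ ∘ there)
      where
      occurs-past : ∀ {e′} → e′ ≺ e → Occurs (map Q.πᵗ zs) (Q.πᵗ e′) (number e′)
      occurs-past e′≺e = subst (Occurs (map Q.πᵗ zs) _)
        (trans (sym (index≡ (there (past e′≺e)))) (index≡number (ι (there (past e′≺e)))))
        (index-occurs (past e′≺e))

      head : ∀ {s j} → j < Fˢᵗ s (Q.πᵗ e) →
             IsToken (Occurs (map Q.πᵗ zs)) s (assignQ s (Q.πᵗ e) (count (map Q.πᵗ zs) (Q.πᵗ e)) j)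
      head {s} {j} j< = subst₂ (IsToken _) (place-label x) (sym (assignQ-slot x))
        (named-isToken (name-named (place x)) (λ 0< →
          occurs-past (Plus._∷_ {y = inj₁ (place x)} 0< [ place-F x ])))
        where
        x : Slot s (Q.πᵗ e) (count (map Q.πᵗ zs) (Q.πᵗ e)) j
        x = slot {event = e} (fromℕ< j<) refl
          (trans (sym (index≡number (ι (here refl)))) (index≡ (here refl))) (toℕ-fromℕ< j<)

    assignQ-closed : Closed assignQ σQ
    assignQ-closed = assignQ-closed′ es es! id (λ _ → refl)

    wiringQ : Wiring (Occurs σQ)
    wiringQ = finiteWiring (λ _ → refl) assignQ-closed assignQ-injective

    number-occurs : ∀ e → Occurs σQ (Q.πᵗ e) (number e)
    number-occurs e = index-occurs (member e)

    name-isToken : ∀ p → IsToken (Occurs σQ) (Q.πˢ p) (name p)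
    name-isToken p = named-isToken (name-named p) (λ {e} _ → number-occurs e)

    named-≼ : Q ≼ process wiringQ
    named-≼ = record
      { ιˢ           = λ p → Q.πˢ p , name p , name-isToken p
      ; ιᵗ           = λ e → Q.πᵗ e , number e , number-occurs e
      ; ιˢ-injective = λ eq → name-injective (cong (proj₁ ∘ proj₂) eq) (cong proj₁ eq)
      ; ιᵗ-injective = λ eq → number-injective (cong proj₁ eq) (cong (proj₁ ∘ proj₂) eq)
      ; M₀-pres      = λ p → χ-unique (M₀≤1 p) (M₀-initial⁺ (name-named p)) (M₀-initial⁻ (name-named p))
      ; M₀-covered   = M₀-covered
      ; Fˢᵗ-pres     = λ p e → χ-unique (∣∣≤1⇒≤1 (Q.postset-≤1 p) e) (consumes p e) (consumed⁻ p e)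
      ; Fᵗˢ-pres     = λ e p → χ-unique (∣∣≤1⇒≤1 (Q.preset-≤1 p) e) (produces e p) (produced⁻ e p)
      ; πˢ-pres      = λ _ → refl
      ; πᵗ-pres      = λ _ → refl
      }
      where
      M₀-initial⁺ : ∀ {p x} → Named p x → 0 < Q.M₀ p → Initial x
      M₀-initial⁺ (initial i _ eq)  _  = toℕ i , eq
      M₀-initial⁺ (output e _ eq _) 0< = ⊥-elim (<-irrefl (sym (produced⇒M₀ (e , output⇒F eq))) 0<)

      M₀-initial⁻ : ∀ {p x} → Named p x → Initial x → 0 < Q.M₀ p
      M₀-initial⁻ (initial i eq _)      _        = initial⇒M₀ eq
      M₀-initial⁻ (output _ _ _ refl) (_ , ())

      M₀-covered : ∀ x → 0 < χ (Initial (proj₁ (proj₂ x))) →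
                   ∃[ p ] (Q.πˢ p , name p , name-isToken p) ≡ x
      M₀-covered (s , .(inj₁ _) , initial i<) _ =
        p , lemma (Init.label s (fromℕ< i<))
              (trans (named-functional (name-named p) p-named) (cong inj₁ (toℕ-fromℕ< i<)))
        where
        p = Init.item s (fromℕ< i<)
        p-named : Named p (inj₁ (toℕ (fromℕ< i<)))
        p-named = relabel (Init.label s (fromℕ< i<)) refl
          where
          relabel : ∀ {s i} → Q.πˢ p ≡ s → Init.item s i ≡ p → Named p (inj₁ (toℕ i))
          relabel refl eq = initial _ eq refl
        lemma : ∀ {s x} {tok : IsToken (Occurs σQ) s x} → Q.πˢ p ≡ s → name p ≡ x →
                (Q.πˢ p , name p , name-isToken p) ≡ (s , x , tok)
        lemma refl refl = place-≡ wiringQ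
      M₀-covered (s , .(inj₂ _) , output _ _) 0< with () ← proj₂ (χ-pos⁻ 0<)

      slot-for : ∀ e {s} (i : Fin (Fˢᵗ s (Q.πᵗ e))) → Slot s (Q.πᵗ e) (number e) (toℕ i)
      slot-for e i = slot {event = e} i refl refl refl

      consumes : ∀ p e → 0 < Q.Fˢᵗ p e → Consumes assignQ (Q.πˢ p) (Q.πᵗ e) (number e) (name p)
      consumes p e 0< with i , eq ← Pre.surjective e (Q.πˢ p) refl 0< =
        toℕ i , toℕ<n i , trans (assignQ-slot (slot-for e i)) (cong name eq)

      consumed⁻ : ∀ p e → Consumes assignQ (Q.πˢ p) (Q.πᵗ e) (number e) (name p) → 0 < Q.Fˢᵗ p e
      consumed⁻ p e (j , j< , eq) = subst (λ q → 0 < Q.Fˢᵗ q e)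
        (name-injective (trans (sym (assignQ-slot x)) eq) (place-label x)) (place-F x)
        where
        x : Slot (Q.πˢ p) (Q.πᵗ e) (number e) j
        x = slot {event = e} (fromℕ< j<) refl refl (toℕ-fromℕ< j<)

      produces : ∀ e p → 0 < Q.Fᵗˢ e p → Produces (Q.πᵗ e) (number e) (name p)
      produces e p 0< with i , eq ← Post.surjective e (Q.πˢ p) refl 0< =
        toℕ i , named-functional (name-named p) (output e i eq refl)

      produced⁻ : ∀ e p → Produces (Q.πᵗ e) (number e) (name p) → 0 < Q.Fᵗˢ e p
      produced⁻ e p (j , eq) with name-named p
      ... | initial _ _ eq′ with () ← trans (sym eq) eq′
      ... | output e′ i item≡ eq′ = subst (λ e → 0 < Q.Fᵗˢ e p)
        (sym (event≡ (trans (sym eq) eq′))) (output⇒F item≡)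
        where
        event≡ : ∀ {m n} →
          _≡_ {A = Token} (inj₂ (Q.πᵗ e , number e , m)) (inj₂ (Q.πᵗ e′ , number e′ , n)) → e ≡ e′
        event≡ eq = let πᵗ≡ , number≡ , _ = output-injective eq in number-injective πᵗ≡ number≡

  module _ (disjoint : ConcurrentlyDisjoint) where

    open Persistence disjoint

    -- The largest process

    -- As the firings of each `t` are numbered from zero, this is inclusion of the sets of
    -- occurrences.
    record _⊑_ (σ τ : List T) : Set ℓ where
      constructor count-≤
      field at : ∀ t → count σ t ≤ count τ t
    open _⊑_

    ⊑-occurs : ∀ {σ τ} → σ ⊑ τ → ∀ {t k} → Occurs σ t k → Occurs τ t k
    ⊑-occurs σ⊑τ {t} o = <-≤-trans o (at σ⊑τ t)

    ⊑-++ : ∀ α {σ} → σ ⊑ (α ++ σ)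
    ⊑-++ α {σ} = count-≤ λ t → subst (count σ t ≤_) (sym (count-++ α σ t)) (m≤n+m _ _)

    ⊑-trans : ∀ {ρ σ τ} → ρ ⊑ σ → σ ⊑ τ → ρ ⊑ τ
    ⊑-trans p q = count-≤ λ t → ≤-trans (at p t) (at q t)

    ∷-⊑ : ∀ {t σ τ} → σ ⊑ τ → count σ t < count τ t → (t ∷ σ) ⊑ τ
    ∷-⊑ {t} {σ} {τ} σ⊑τ t< = count-≤ bound
      where
      bound : ∀ u → count (t ∷ σ) u ≤ count τ u
      bound u with t ≟ u
      ... | yes refl = subst (_≤ count τ t) (sym (count-here t σ)) t<
      ... | no t≢u   = subst (_≤ count τ u) (sym (count-there σ t≢u)) (at σ⊑τ u)

    occurs-++⁻ : ∀ α {τ t k} → Occurs (α ++ τ) t k →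
      Occurs τ t k ⊎ ∃[ α₂ ] ∃[ α₁ ] α ≡ α₂ ++ t ∷ α₁
    occurs-++⁻ []      o = inj₁ o
    occurs-++⁻ (u ∷ α) o with occurs-∷⁻ (α ++ _) o
    ... | inj₂ (refl , _) = inj₂ ([] , α , refl)
    ... | inj₁ o′ with occurs-++⁻ α o′
    ...   | inj₁ o″                = inj₁ o″
    ...   | inj₂ (α₂ , α₁ , refl) = inj₂ (u ∷ α₂ , α₁ , refl)

    below⇒≤ : ∀ {m n} → (∀ {k} → k < m → k < n) → m ≤ n
    below⇒≤ {zero}  f = z≤n
    below⇒≤ {suc m} f = f ≤-refl

    -- Configurations of a wiring and their unions

    module Configurations {D} (W : Wiring D) where
      open Wiring W renaming (assign to f)

      Configuration : List T → Set ℓ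
      Configuration σ = Closed f σ × (∀ {t k} → Occurs σ t k → D t k)

      configuration⇒firable : ∀ {σ} → Configuration σ → Firable σ
      configuration⇒firable (σ! , sub) = closed⇒firable σ! (InjectiveOn-mono {f = f} sub injective)

      -- The firing of `t` numbered `count τ t` is either present in `α ++ σ` already or is the next
      -- one there. In the latter case it can be added, as its inputs are tokens from `τ`.
      union : ∀ {σ} τ → Configuration σ → Configuration τ →
              ∃[ α ] Configuration (α ++ σ) × τ ⊑ (α ++ σ)
      union []      cσ _ = [] , cσ , count-≤ λ _ → z≤n
      union {σ} (t ∷ τ) cσ ((t! ∷ τ!) , sub) with union τ cσ (τ! , sub ∘ occurs-there τ)
      ... | α , cα@(α! , subα) , τ⊑ with count τ t <? count (α ++ σ) t
      ...   | yes t< = α , cα , ∷-⊑ τ⊑ t<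
      ...   | no  t≮ = t ∷ α , (head ∷ α! , sub′) , ∷-⊑ (⊑-trans τ⊑ (⊑-++ (t ∷ []))) t<
        where
        eq : count τ t ≡ count (α ++ σ) t
        eq = ≤-antisym (at τ⊑ t) (≮⇒≥ t≮)
        head : ∀ {s j} → j < Fˢᵗ s t → IsToken (Occurs (α ++ σ)) s (f s t (count (α ++ σ) t) j)
        head {s} {j} j< = IsToken-mono (⊑-occurs τ⊑) (subst (λ k → IsToken (Occurs τ) s (f s t k j)) eq (t! j<))
        sub′ : ∀ {u k} → Occurs (t ∷ α ++ σ) u k → D u k
        sub′ o with occurs-∷⁻ (α ++ σ) o
        ... | inj₁ o′            = subα o′
        ... | inj₂ (refl , refl) = sub (subst (Occurs (t ∷ τ) t) eq (occurs-here t τ))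
        t< : count τ t < count (t ∷ α ++ σ) t
        t< = subst₂ _<_ (sym eq) (sym (count-here t (α ++ σ))) ≤-refl

      gather : ∀ {X : Set ℓ} (R : X → List T → Set ℓ) → (∀ {x σ τ} → σ ⊑ τ → R x σ → R x τ) →
        ∀ xs → (∀ {x} → x ∈ xs → ∃[ σ ] Configuration σ × R x σ) →
        ∃[ σ ] Configuration σ × (∀ {x} → x ∈ xs → R x σ)
      gather R mono []       _  = [] , ([] , λ ()) , λ ()
      gather R mono (x ∷ xs) each
        with σ , cσ , Rσ ← each (here refl)
        with τ , cτ , Rτ ← gather R mono xs (each ∘ there)
        with α , c , τ⊑ ← union τ cσ cτ =
        α ++ σ , c , λ { (here refl) → mono (⊑-++ α) Rσ ; (there x∈) → mono τ⊑ (Rτ x∈) }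

      token-support : ∀ {s p} → IsToken D s p → ∃[ σ ] Configuration σ × IsToken (Occurs σ) s p
      token-support (initial i<)  = [] , ([] , λ ()) , initial i<
      token-support (output d j<) with σ , σ! , o , sub ← support d = σ , (σ! , sub) , output o j<

      Supplied : ∀ {t} → Choice D D f t → S × ℕ → List T → Set ℓ
      Supplied {t} C (s , j) σ = j < Fˢᵗ s t → IsToken (Occurs σ) s (Choice.pick C s j)

      input-support : ∀ {t} (C : Choice D D f t) x → ∃[ σ ] Configuration σ × Supplied C x σ
      input-support {t} C (s , j) with j <? Fˢᵗ s t
      ... | no j≮  = [] , ([] , λ ()) , λ j< → ⊥-elim (j≮ j<)
      ... | yes j< with σ , cσ , tok ← token-support (Choice.isToken C j<) = σ , cσ , λ _ → tok

      -- Only finitely many tokens are picked, so a union of finitely many configurations provides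
      -- them all.
      choice-support : ∀ {t} (C : Choice D D f t) →
        ∃[ σ ] Configuration σ × (∀ {s j} → j < Fˢᵗ s t → IsToken (Occurs σ) s (Choice.pick C s j))
      choice-support {t} C with σ , cσ , all ← gather (Supplied C)
          (λ σ⊑τ tok j< → IsToken-mono (⊑-occurs σ⊑τ) (tok j<)) (inputSlots t) (λ {x} _ → input-support C x) =
          σ , cσ , λ j< → all (∈-inputSlots t j<) j<

      choice-enabled : ∀ {σ t} (C : Choice D D f t) → Configuration σ →
        (∀ {s j} → j < Fˢᵗ s t → IsToken (Occurs σ) s (Choice.pick C s j)) → Enabled σ t
      choice-enabled C (σ! , sub) tok = choice⇒enabled σ! (InjectiveOn-mono {f = f} sub injective) (record
        { pick      = Choice.pick C
        ; isToken   = tok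
        ; fresh     = λ j< o → Choice.fresh C j< (sub o)
        ; injective = Choice.injective C
        })

      -- `D` may be infinite, so it need not have a firing sequence. In the union of the two
      -- supports, however, both transitions are enabled, and disjointness applies there.
      choices-disjoint : ∀ {t u} → Choice D D f t → Choice D D f u → t ≢ u →
        ∀ s → Fˢᵗ s t ≡ 0 ⊎ Fˢᵗ s u ≡ 0
      choices-disjoint C C′ t≢u
        with σ , cσ , tok ← choice-support C | τ , cτ , tok′ ← choice-support C′
        with α , c , τ⊑ ← union τ cσ cτ = disjoint (configuration⇒firable c)
          (choice-enabled C c (IsToken-mono (⊑-occurs (⊑-++ α)) ∘ tok))
          (choice-enabled C′ c (IsToken-mono (⊑-occurs τ⊑) ∘ tok′)) t≢u

    record Stage : Set ℓ where
      field
        size   : T → ℕ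
        wiring : Wiring (Below size)
      open Wiring wiring public

      Ready : T → Set ℓ
      Ready = Choice (Below size) (Below size) assign

    -- All transitions that are ready fire at once; their presets are disjoint.
    module Step (A : Stage) where
      open Stage A
      open Configurations wiring

      picked : ∀ {t} → Dec (Ready t) → S → ℕ → Token
      picked (yes C) = Choice.pick C
      picked (no _)  = λ _ _ → inj₁ 0

      size⁺ : T → ℕ
      size⁺ t = χ (Ready t) + size t

      assign⁺ : Assignment
      -- If `t` is not ready, the number `size t` stays outside the domain and the value there is
      -- irrelevant.
      assign⁺ s t k j = if does (k ℕ.≟ size t) then picked (decide (Ready t)) s j else assign s t k j

      assign-new : ∀ {s t j} → assign⁺ s t (size t) j ≡ picked (decide (Ready t)) s j
      assign-new {t = t} = if-yes (size t ℕ.≟ size t) refl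

      assign-old : AgreeOn (Below size) assign assign⁺
      assign-old {t = t} {k} k< _ = sym (if-no (k ℕ.≟ size t) (<⇒≢ k<))

      New : T → ℕ → Set ℓ
      New t k = k ≡ size t × Ready t

      size-≤ : ∀ t → size t ≤ size⁺ t
      size-≤ t = m≤n+m _ _

      ready⇒below : ∀ {t} → Ready t → Below size⁺ t (size t)
      ready⇒below {t} C = ≤-reflexive (sym (cong (_+ size t) (χ-yes C)))

      split : ∀ {t k} → Below size⁺ t k → Below size t k ⊎ New t k
      split {t} {k} k< with decide (Ready t)
      ... | no ¬C = inj₁ (subst (k <_) (cong (_+ size t) (χ-no ¬C)) k<)
      ... | yes C with m<1+n⇒m<n∨m≡n (subst (k <_) (cong (_+ size t) (χ-yes C)) k<)
      ...   | inj₁ k<′ = inj₁ k<′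
      ...   | inj₂ eq  = inj₂ (eq , C)

      picked-choice : ∀ {t} → Ready t → Σ[ C ∈ Ready t ] picked (decide (Ready t)) ≡ Choice.pick C
      picked-choice {t} C with em {Lift _ (Ready t)}
      ... | yes (lift C′) = C′ , refl
      ... | no ¬C         = ⊥-elim (¬C (lift C))

      new-injective : InjectiveOn New assign⁺
      new-injective {s} {t} {t′ = u} (refl , C) j< (refl , C′) j<′ eq with t ≟ u
      ... | no t≢u = ⊥-elim ([ (λ t0 → <-irrefl refl (subst (_ <_) t0 (≤-<-trans z≤n j<))) ,
                               (λ u0 → <-irrefl refl (subst (_ <_) u0 (≤-<-trans z≤n j<′))) ]′
                             (choices-disjoint C C′ t≢u s))
      ... | yes refl with C₀ , pick≡ ← picked-choice C =
        cong (λ j → t , size t , j) (Choice.injective C₀ j< j<′ (begin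
          _  ≡⟨ cong (λ d → d s _) pick≡ ⟨
          _  ≡⟨ assign-new ⟨
          _  ≡⟨ eq ⟩
          _  ≡⟨ assign-new ⟩
          _  ≡⟨ cong (λ d → d s _) pick≡ ⟩
          _  ∎))
        where open ≡-Reasoning

      assign⁺-injective : InjectiveOn (Below size⁺) assign⁺
      assign⁺-injective = InjectiveOn-⊎ {E = New} {f = assign⁺} split
        (InjectiveOn-cong assign-old injective) new-injective apart
        where
        apart : ∀ {s t k j u l i} → Below size t k → j < Fˢᵗ s t → New u l → i < Fˢᵗ s u →
                assign⁺ s t k j ≢ assign⁺ s u l i
        apart {s} k< j< (refl , C) i< eq with C₀ , pick≡ ← picked-choice C =
          Choice.fresh C₀ i< k< j< (trans (assign-old k< j<)
            (trans eq (trans assign-new (cong (λ d → d s _) pick≡))))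

      -- The new firing of `t` is numbered `size t`, so a firing order ending in it must contain all
      -- previous firings of `t`. Supporting the last of them suffices.
      saturate : ∀ {σ} t → Configuration σ → ∃[ τ ] Configuration τ × σ ⊑ τ × count τ t ≡ size t
      saturate {σ} t cσ with size t in size≡
      ... | zero = σ , cσ , count-≤ (λ _ → ≤-refl) ,
        n≤0⇒n≡0 (subst (count σ t ≤_) size≡ (below⇒≤ (proj₂ cσ {t})))
      ... | suc m with τ , τ! , o , sub ← support {t} {m} (subst (m <_) (sym size≡) ≤-refl)
        with α , c , τ⊑ ← union τ cσ (τ! , sub) =
        α ++ σ , c , ⊑-++ α , ≤-antisym (subst (count (α ++ σ) t ≤_) size≡ (below⇒≤ (proj₂ c {t})))
                                (≤-trans o (at τ⊑ t))

      support⁺ : ∀ {t k} → Below size⁺ t k →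
        ∃[ σ ] Closed assign⁺ σ × Occurs σ t k × (∀ {u i} → Occurs σ u i → Below size⁺ u i)
      support⁺ k< with split k<
      ... | inj₁ k<′ with σ , σ! , o , sub ← support k<′ =
        σ , closed-cong (assign-old ∘ sub) σ! , o , λ {u} o′ → <-≤-trans (sub o′) (size-≤ u)
      support⁺ {t} k< | inj₂ (refl , C) with C₀ , pick≡ ← picked-choice C
        with σ₀ , c₀ , tok ← choice-support C₀
        with σ , (σ! , sub) , σ₀⊑ , size≡ ← saturate t c₀ =
        t ∷ σ , head ∷ closed-cong (assign-old ∘ sub) σ! ,
        subst (Occurs (t ∷ σ) t) size≡ (occurs-here t σ) , sub⁺
        where
        head : ∀ {s j} → j < Fˢᵗ s t → IsToken (Occurs σ) s (assign⁺ s t (count σ t) j)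
        head {s} {j} j< = subst (IsToken (Occurs σ) s)
          (sym (trans (cong (λ k → assign⁺ s t k j) size≡) (trans assign-new (cong (λ d → d s j) pick≡))))
          (IsToken-mono (⊑-occurs σ₀⊑) (tok j<))
        sub⁺ : ∀ {u i} → Occurs (t ∷ σ) u i → Below size⁺ u i
        sub⁺ {u} o with occurs-∷⁻ σ o
        ... | inj₁ o′            = <-≤-trans (sub o′) (size-≤ u)
        ... | inj₂ (refl , refl) = subst (Below size⁺ t) (sym size≡) k<

      next : Stage
      next = record
        { size   = size⁺
        ; wiring = record
          { irrelevant = <-irrelevant
          ; assign     = assign⁺
          ; injective  = assign⁺-injective
          ; support    = support⁺
          }
        }

    stage : ℕ → Stage
    stage zero    = record
      { size   = λ _ → 0
      ; wiring = record
        { irrelevant = <-irrelevant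
        ; assign     = λ _ _ _ _ → inj₁ 0
        ; injective  = λ ()
        ; support    = λ ()
        }
      }
    stage (suc n) = Step.next (stage n)

    module Stage-n (n : ℕ) = Stage (stage n)
    open Stage-n using (size; assign)

    size-mono : ∀ {m n} → m ≤′ n → ∀ t → size m t ≤ size n t
    size-mono ≤′-refl               t = ≤-refl
    size-mono (≤′-step {n = n} m≤n) t = ≤-trans (size-mono m≤n t) (Step.size-≤ (stage n) t)

    below-mono : ∀ {m n} → m ≤ n → ∀ {t k} → Below (size m) t k → Below (size n) t k
    below-mono m≤n {t} k< = <-≤-trans k< (size-mono (≤⇒≤′ m≤n) t)

    assign-mono′ : ∀ {m n} → m ≤′ n → AgreeOn (Below (size m)) (assign m) (assign n)
    assign-mono′ ≤′-refl               _  _  = refl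
    assign-mono′ (≤′-step {n = n} m≤n) {t = t} k< j< = trans (assign-mono′ m≤n k< j<)
      (Step.assign-old (stage n) (<-≤-trans k< (size-mono m≤n t)) j<)

    assign-agree : ∀ {m n s t k j} → Below (size m) t k → Below (size n) t k → j < Fˢᵗ s t →
                   assign m s t k j ≡ assign n s t k j
    assign-agree {m} {n} k<m k<n j< with ≤-total m n
    ... | inj₁ m≤n = assign-mono′ (≤⇒≤′ m≤n) k<m j<
    ... | inj₂ n≤m = sym (assign-mono′ (≤⇒≤′ n≤m) k<n j<)

    -- The limit of the stages

    Fires : T → ℕ → Set ℓ
    Fires t k = Lift ℓ (∃[ n ] Below (size n) t k)

    -- Truncated, so that it is a proposition.
    D∞ : T → ℕ → Set
    D∞ t k = True (decide (Fires t k))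

    D∞⁺ : ∀ n {t k} → Below (size n) t k → D∞ t k
    D∞⁺ n {t} {k} k< = fromWitness {a? = decide (Fires t k)} (lift (n , k<))

    D∞⁻ : ∀ {t k} → D∞ t k → ∃[ n ] Below (size n) t k
    D∞⁻ {t} {k} d = lower (toWitness {a? = decide (Fires t k)} d)

    -- Which stage the decision yields is immaterial, since stages agree wherever both are defined.
    assign∞ : Assignment
    assign∞ s t k j = choose-stage (decide (Fires t k))
      where
      choose-stage : Dec (Fires t k) → Token
      choose-stage (yes (lift (n , _))) = assign n s t k j
      choose-stage (no _)               = inj₁ 0

    agree∞ : ∀ n → AgreeOn (Below (size n)) (assign n) assign∞
    agree∞ n {t = t} {k} k< j< with em {Lift _ (Fires t k)}
    ... | yes (lift (lift (m , k<′))) = assign-agree {n} {m} k< k<′ j<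
    ... | no ¬fires                   = ⊥-elim (¬fires (lift (lift (n , k<))))

    assign∞-injective : InjectiveOn D∞ assign∞
    assign∞-injective d j< d′ j<′ eq with m , k< ← D∞⁻ d | n , k<′ ← D∞⁻ d′ =
      InjectiveOn-cong (agree∞ (m ⊔ n)) (Stage-n.injective (m ⊔ n))
        (below-mono (m≤m⊔n m n) k<) j< (below-mono (m≤n⊔m m n) k<′) j<′ eq

    wiring∞ : Wiring D∞
    wiring∞ = record
      { irrelevant = T-irrelevant
      ; assign     = assign∞
      ; injective  = assign∞-injective
      ; support    = support∞
      }
      where
      support∞ : ∀ {t k} → D∞ t k →
        ∃[ σ ] Closed assign∞ σ × Occurs σ t k × (∀ {u i} → Occurs σ u i → D∞ u i)
      support∞ d with n , k< ← D∞⁻ d with σ , σ! , o , sub ← Stage-n.support n k< =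
        σ , closed-cong (agree∞ n ∘ sub) σ! , o , λ o′ → D∞⁺ n (sub o′)

    open Configurations wiring∞

    within-stage : ∀ σ → (∀ {t k} → Occurs σ t k → D∞ t k) →
                   ∃[ n ] (∀ {t k} → Occurs σ t k → Below (size n) t k)
    within-stage []      _   = 0 , λ ()
    within-stage (t ∷ σ) sub with m , below ← within-stage σ (sub ∘ occurs-there σ)
      | n , here< ← D∞⁻ (sub (occurs-here t σ)) = m ⊔ n , both
      where
      both : ∀ {u k} → Occurs (t ∷ σ) u k → Below (size (m ⊔ n)) u k
      both o with occurs-∷⁻ σ o
      ... | inj₁ o′            = below-mono (m≤m⊔n m n) (below o′)
      ... | inj₂ (refl , refl) = below-mono (m≤n⊔m m n) here<

    -- If t is not ready at a stage containing τ, then one of the tokens that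
    -- enable it after τ has been taken by some (u , k). As t stays enabled
    -- until it fires, t fires before (u , k) or is u itself.
    fire-again : ∀ {τ t} → Configuration τ → Enabled τ t →
                 ∃[ ρ ] Configuration ρ × τ ⊑ ρ × count τ t < count ρ t
    fire-again {τ} {t} cτ@(τ! , sub) t! = again (decide (Stage.Ready (stage n) t))
      where
      C = choose τ τ {assign∞} {t} t!
      module C = Choice C
      stage-n = within-stage τ sub
      n = proj₁ stage-n
      τ-below = proj₂ stage-n

      Taken : Set ℓ
      Taken = Σ[ s ∈ S ] Σ[ j ∈ ℕ ] Σ[ u ∈ T ] Σ[ k ∈ ℕ ] Σ[ i ∈ ℕ ] (j < Fˢᵗ s t ×
              Below (size n) u k × i < Fˢᵗ s u × assign n s u k i ≡ C.pick s j)

      taken-again : Taken → ∃[ ρ ] Configuration ρ × τ ⊑ ρ × count τ t < count ρ t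
      taken-again (s , j , u , k , i , j< , k< , i< , eq)
        with σ , σ! , o , sub-σ ← Wiring.support wiring∞ (D∞⁺ n k<)
        with α , c , σ⊑ ← union σ cτ (σ! , sub-σ)
        with count τ t <? count (α ++ τ) t
      ... | yes t< = α ++ τ , c , ⊑-++ α , t<
      ... | no  t≮ with occurs-++⁻ α (⊑-occurs σ⊑ o)
      -- The chosen tokens are fresh for `τ`, so their taker cannot occur in `τ`.
      ...   | inj₁ o′ = ⊥-elim (C.fresh j< o′ i< (trans (sym (agree∞ n k< i<)) eq))
      -- Here `t` and `u` would both be enabled after `α₁ ++ τ` and both take tokens from `s`,
      -- against disjointness.
      ...   | inj₂ (α₂ , α₁ , refl) = ⊥-elim ([ zero-absurd j< , zero-absurd i< ]′
                (disjoint firable-tail (persist* α₁ firable-tail t! α₁∌t) u! t≢u s))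
        where
        zero-absurd : ∀ {m n} → m < n → n ≢ 0
        zero-absurd m<n refl with () ← m<n

        firable-u : Firable (u ∷ α₁ ++ τ)
        firable-u = firable-++⁻ α₂ (subst Firable (++-assoc α₂ (u ∷ α₁) τ) (configuration⇒firable c))

        firable-tail : Firable (α₁ ++ τ)
        firable-tail with _ ∷ h ← firable-u = h

        u! : Enabled (α₁ ++ τ) u
        u! with h ∷ _ ← firable-u = h

        α∌t : count (α₂ ++ u ∷ α₁) t ≡ 0
        α∌t = n≤0⇒n≡0 (+-cancelʳ-≤ (count τ t) _ 0
          (subst (_≤ count τ t) (count-++ (α₂ ++ u ∷ α₁) τ t) (≮⇒≥ t≮)))

        u∷α₁∌t : count (u ∷ α₁) t ≡ 0
        u∷α₁∌t = m+n≡0⇒n≡0 (count α₂ t) (trans (sym (count-++ α₂ (u ∷ α₁) t)) α∌t)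

        t≢u : t ≢ u
        t≢u = proj₁ (count-∷≡0 α₁ u∷α₁∌t)

        α₁∌t : count α₁ t ≡ 0
        α₁∌t = proj₂ (count-∷≡0 α₁ u∷α₁∌t)

      again : Dec (Stage.Ready (stage n) t) → ∃[ ρ ] Configuration ρ × τ ⊑ ρ × count τ t < count ρ t
      -- The next stage fires `t` with number `size n t`, which is at least `count τ t` because `τ`
      -- lies within stage `n`.
      again (yes R)
        with σ , σ! , o , sub-σ ← Wiring.support wiring∞ (D∞⁺ (suc n) (Step.ready⇒below (stage n) R))
        with α , c , σ⊑ ← union σ cτ (σ! , sub-σ) =
        α ++ τ , c , ⊑-++ α , ≤-<-trans (below⇒≤ (τ-below {t})) (<-≤-trans o (at σ⊑ t))
      again (no ¬R) with decide Taken
      ... | yes taken  = taken-again taken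
      ... | no ¬taken = ⊥-elim (¬R (record
        { pick      = C.pick
        ; isToken   = λ j< → IsToken-mono τ-below (C.isToken j<)
        ; fresh     = λ j< k< i< eq → ¬taken (_ , _ , _ , _ , _ , j< , k< , i< , eq)
        ; injective = C.injective
        }))

    -- If `τ` has no more firings of `t` than `σ`, then `t`, enabled after `σ`, is still enabled
    -- after `τ`. The stages never postpone an enabled transition forever, so a larger configuration
    -- contains one more firing.
    dominate : ∀ {σ} → Firable σ → ∃[ τ ] Configuration τ × σ ⊑ τ
    dominate [] = [] , ([] , λ ()) , count-≤ λ _ → z≤n
    dominate (_∷_ {t} {σ} t! σ!) with τ , cτ , σ⊑τ ← dominate σ! with count σ t <? count τ t
    ... | yes t< = τ , cτ , ∷-⊑ σ⊑τ t<
    ... | no  t≮ with ρ , cρ , τ⊑ρ , t< ← fire-again cτ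
          (still-enabled σ! (configuration⇒firable cτ) (at σ⊑τ) (≤-antisym (at σ⊑τ t) (≮⇒≥ t≮)) t!) =
      ρ , cρ , ∷-⊑ (⊑-trans σ⊑τ τ⊑ρ) (≤-<-trans (at σ⊑τ t) t<)

    ≼-trans : ∀ {P Q R : GRProcess N} → P ≼ Q → Q ≼ R → P ≼ R
    ≼-trans f g = record
      { ιˢ           = g.ιˢ ∘ f.ιˢ
      ; ιᵗ           = g.ιᵗ ∘ f.ιᵗ
      ; ιˢ-injective = f.ιˢ-injective ∘ g.ιˢ-injective
      ; ιᵗ-injective = f.ιᵗ-injective ∘ g.ιᵗ-injective
      ; M₀-pres      = λ s → trans (f.M₀-pres s) (g.M₀-pres (f.ιˢ s))
      ; M₀-covered   = covered
      ; Fˢᵗ-pres     = λ s t → trans (f.Fˢᵗ-pres s t) (g.Fˢᵗ-pres (f.ιˢ s) (f.ιᵗ t))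
      ; Fᵗˢ-pres     = λ t s → trans (f.Fᵗˢ-pres t s) (g.Fᵗˢ-pres (f.ιᵗ t) (f.ιˢ s))
      ; πˢ-pres      = λ s → trans (f.πˢ-pres s) (g.πˢ-pres (f.ιˢ s))
      ; πᵗ-pres      = λ t → trans (f.πᵗ-pres t) (g.πᵗ-pres (f.ιᵗ t))
      }
      where
      module f = RawPrefix f
      module g = RawPrefix g
      covered : ∀ s → _ → ∃[ s′ ] g.ιˢ (f.ιˢ s′) ≡ s
      covered s 0< with s₁ , refl ← g.M₀-covered s 0<
        with s₂ , refl ← f.M₀-covered s₁ (subst (0 <_) (sym (g.M₀-pres s₁)) 0<) = s₂ , refl

    -- The continuation `α` may take any tokens that are free, as the subsequent swaps turn the
    -- whole assignment into `assign∞`. Exchanges leave the occurrences of `τ` unchanged, so the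
    -- result is a prefix of the limit.
    extend-to : ∀ {P : GRProcess N} {σ τ} (W : Wiring (Occurs σ)) → Closed (Wiring.assign W) σ →
      P ≼ process W → Configuration τ → σ ⊑ τ →
      ∃[ P′ ] ∃[ Q′ ] FiniteProcess P′ × FiniteProcess Q′ × P ≼ P′ × P′ ≡₁* Q′ × Q′ ≼ process wiring∞
    extend-to {P} {σ} {τ} W σ! P≼W cτ σ⊑τ =
      let α , τ≋ = residual-of (closed⇒firable σ! (Wiring.injective W)) (configuration⇒firable cτ) (at σ⊑τ)
          ασ! = ≋-firable τ≋ (configuration⇒firable cτ)
          g , W≈g , g! , g-inj = extendAlong α ασ! σ! (Wiring.injective W)
      in finish α τ≋ ασ! (finiteWiring (λ _ → refl) g! g-inj) g! W≈g
      where
      finish : ∀ α → τ ≋ α ++ σ → Firable (α ++ σ) → (W₁ : Wiring (Occurs (α ++ σ))) →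
        Closed (Wiring.assign W₁) (α ++ σ) → AgreeOn (Occurs σ) (Wiring.assign W) (Wiring.assign W₁) →
        ∃[ P′ ] ∃[ Q′ ] FiniteProcess P′ × FiniteProcess Q′ × P ≼ P′ × P′ ≡₁* Q′ × Q′ ≼ process wiring∞
      finish α τ≋ ασ! W₁ W₁! W≈W₁ =
        let W₂ , W₁→W₂ , W₂≈ = align-≋ disjoint (InjectiveOn-mono {f = assign∞} sub assign∞-injective)
              (Star.reverse swap-sym τ≋) ασ! (λ _ → refl) W₁ W₁! (proj₁ cτ)
        in process W₁ , process W₂ ,
           finiteProcess-finite {W = W₁} (α ++ σ) (λ _ → refl) ,
           finiteProcess-finite {W = W₂} (α ++ σ) (λ _ → refl) ,
           ≼-trans {P} {process W} {process W₁} P≼W (inclusion W W₁ (occurs-++ʳ α) W≈W₁) ,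
           W₁→W₂ , inclusion W₂ wiring∞ sub W₂≈
        where
        sub : ∀ {t k} → Occurs (α ++ σ) t k → D∞ t k
        sub o = proj₂ cτ (below-resp (sym ∘ ≋-count τ≋) o)

    process∞-largest : ∀ Q → Q ⊑₁^∞ process wiring∞
    process∞-largest Q P finite _ =
      let τ , cτ , σ⊑τ = dominate (closed⇒firable (assignQ-closed P finite) (assignQ-injective P finite)) in
      extend-to {P} (wiringQ P finite) (assignQ-closed P finite) (named-≼ P finite) cτ σ⊑τ

theorem2 : ∀ {ℓ} (em : ExcludedMiddle (Level.suc ℓ)) → let open PetriNets em in
    (N : Net ℓ) → ConflictFree N → IsStructuralConflictNet N →
    ∃[ P ] (∀ (Q : GRProcess N) → Q ⊑₁^∞ P)
theorem2 em N conflictFree structural =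
  process em N (wiring∞ em N disjoint) , process∞-largest em N disjoint
  where disjoint = concurrently-disjoint em N conflictFree structural
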